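{- Let $s,t\ge1$ be coprime integers, and put $s'=\lfloor s/2\rfloor$, $t'=\lfloor t/2\rfloor$. (1) The set $\mathcal{D}_s\cap\mathcal{D}_t$ of self-conjugate simultaneous $s$- and $t$-cores is parameterized by each of the following sets: (a) via $a$-coordinates, the set $B_t(s)$ of points $(a_{t,i})_{i\in\mathbb{Z}/t\mathbb{Z}}\in A_t(s)$ satisfying $a_{t,i}+a_{t,-1-i}=t-1$ for all $i$; (b) via $z$-coordinates, the set $U_t(s)$ of points $(z_{t,i})_{i\in\mathbb{Z}/t\mathbb{Z}}\in\mathrm{TD}_t(s)$ satisfying $z_{t,i}=z_{t,-i}$ for all $i$; (c) via $u$-coordinates, the set $\{(u_0,u_1,\ldots,u_{t'})\in\mathbb{Z}_{\ge0}^{1+t'}:u_0+u_1+\cdots+u_{t'}=s'\}$. Here the change of variables from $a$- to $z$-coordinates restricts to a bijection $B_t(s)\to U_t(s)$, and the bijection from $U_t(s)$ to the set in (c) is given by $u_0=\lfloor z_{t,0}/2\rfloor=s'-\sum_{i=1}^{t'}u_i$ together with: $u_i=z_{t,i}$ for $1\le i\le t'$ if $t$ is odd; and $u_{t'}=z_{t,t'}/2$, $u_i=z_{t,i}$ for $1\le i\le t'-1$ if $t$ is even. (2) Under the same changes of coordinates, the set $\mathcal{D}_t$ of self-conjugate $t$-cores is parameterized by each of the following sets: (a) via $a$-coordinates, the set of integer points $(a_{t,i})_{i\in\mathbb{Z}/t\mathbb{Z}}$ with $\sum_ia_{t,i}=\binom t2$, $a_{t,i}\equiv i\pmod t$ and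 $a_{t,i}+a_{t,-1-i}=t-1$ for all $i$; (b) via $z$-coordinates, the set of integer points $(z_{t,i})_{i\in\mathbb{Z}/t\mathbb{Z}}$ with $\sum_iz_{t,i}=s$, $\sum_i i\,z_{t,i}\equiv0\pmod t$, and $z_{t,i}=z_{t,-i}$ for all $i$; (c) via $u$-coordinates (defined from the $z$-coordinates by the same formulas as in (1)), the set $\{(u_0,u_1,\ldots,u_{t'})\in\mathbb{Z}^{1+t'}:u_0+u_1+\cdots+u_{t'}=s'\}$.
   Context: A partition is an infinite weakly decreasing sequence $\lambda=(\lambda_1,\lambda_2,\ldots)$ of nonnegative integers with finite sum; its conjugate $\overline{\lambda}$ is given by $\overline{\lambda}_r=\#\{c\in\mathbb{Z}_{>0}: r\le\lambda_c\}$, and $\lambda$ is self-conjugate if $\lambda=\overline\lambda$. Its beta-set is $B^\lambda=\{\lambda_i-i: i\ge1\}\subset\mathbb{Z}$. A partition is a $t$-core if it has no hook of length $t$, equivalently if $B^\lambda-t\subseteq B^\lambda$; $\mathcal{C}_t$ (resp. $\mathcal{D}_t$) is the set of $t$-cores (resp. self-conjugate $t$-cores). $a$-coordinates: for a $t$-core $\lambda$ and $i\in\mathbb{Z}$ (only $i$ mod $t$ matters), $a_{t,i}(\lambda)=t+\max[B^\lambda\cap(i+t\mathbb{Z})]$. $z$-coordinates: with $k=\frac12(s+1)(t-1)\in\mathbb{Z}$, the change of variables from $a$- to $z$-coordinates is $z_{t,j}=\frac1t\bigl(a_{t,sj+k}-[a_{t,s(j+1)+k}-s]\bigr)$ for $j\in\mathbb{Z}/t\mathbb{Z}$.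 $A_t(s)$ is the set of integer points $(a_{t,i})_{i\in\mathbb{Z}/t\mathbb{Z}}$ with $a_{t,i}\ge a_{t,i+s}-s$ and $a_{t,i}\equiv i\pmod t$ for all $i$, and $\sum_ia_{t,i}=\binom t2$. $\mathrm{TD}_t(s)$ is the set of points $(z_{t,i})_{i\in\mathbb{Z}/t\mathbb{Z}}\in\mathbb{Z}_{\ge0}^t$ with $\sum_iz_{t,i}=s$ and $\sum_i i\,z_{t,i}\equiv0\pmod t$. "Parameterized" means that the map sending a partition to its indicated coordinates is a bijection onto the indicated set. All indices of $a_{t,\cdot}$ and $z_{t,\cdot}$ are taken modulo $t$. -}

module Defs where

open import Data.Bool.Base using (_∧_; if_then_else_)
open import Data.Fin.Base using (Fin; zero; suc; toℕ; fromℕ<)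
open import Data.Integer.Base as ℤ
  using (ℤ; +_; 0ℤ; 1ℤ; -1ℤ; -_; _+_; _-_; _*_; _≤_; _/ℕ_; _%ℕ_)
open import Data.Integer.DivMod using (n%ℕd<d; a≡a%ℕn+[a/ℕn]*n)
open import Data.Integer.Divisibility.Signed using (_∣_; divides)
import Data.Integer.Properties as ℤ
open import Data.Integer.Tactic.RingSolver using (solve-∀)
open import Data.List.Base using (applyUpTo; filter; length; upTo)
open import Data.Nat.Base as ℕ using (ℕ; zero; suc; NonZero; ⌊_/2⌋)
open import Data.Nat.Combinatorics using (_C_)
open import Data.Nat.ListAction using (sum)
import Data.Nat.Divisibility as ℕ
import Data.Nat.Properties as ℕ
open import Data.Product.Base as Product using (∃; _×_; _,_; proj₁; proj₂)
open import Function.Base using (_on_; _∘_)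
open import Function.Structures using (IsBijection)
open import Level using (0ℓ)
open import Relation.Binary.Bundles using (Setoid)
import Relation.Binary.Construct.On as On
open import Relation.Binary.PropositionalEquality hiding ([_])
open import Relation.Nullary using (yes; no; does; contradiction)
open import Relation.Unary using (Pred; Decidable; _∈_; _∩_)

open import Algebra.Properties.CommutativeMonoid.Sum ℤ.+-0-commutativeMonoid
  public using () renaming (sum to ∑)

------------------------------------------------------------------------
-- Partitions

-- Sequences are indexed from 0: `part i` is λ_{i+1}.  Finiteness of the sum
-- is boundedness of the partial sums.

record Partition : Set where
  field
    part       : ℕ → ℕ
    decreasing : ∀ i → part (suc i) ℕ.≤ part i
    bound      : ℕ
    finiteSum  : ∀ n → sum (applyUpTo part n) ℕ.≤ bound

open Partition public

-- Two partitions are equal when their parts are; `bound` is irrelevant.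

Partitions : Setoid 0ℓ 0ℓ
Partitions = On.setoid (ℕ →-setoid ℕ) part

-- `conjugate λ r` is λ̄_{r+1} = #{c : r < part c}.  Counting below `bound`
-- loses nothing, by `part-vanishes`.

conjugate : Partition → ℕ → ℕ
conjugate l r = length (filter (λ c → r ℕ.<? part l c) (upTo (bound l)))

SelfConjugate : Pred Partition 0ℓ
SelfConjugate l = part l ≗ conjugate l

part-antitone : ∀ l {i j} → i ℕ.≤ j → part l j ℕ.≤ part l i
part-antitone l i≤j = go (ℕ.≤⇒≤′ i≤j)
  where
  go : ∀ {i j} → i ℕ.≤′ j → part l j ℕ.≤ part l i
  go ℕ.≤′-refl     = ℕ.≤-refl
  go (ℕ.≤′-step p) = ℕ.≤-trans (decreasing l _) (go p)

part-vanishes : ∀ l c → bound l ℕ.≤ c → part l c ≡ 0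
part-vanishes l c b≤c with part l c in eq
... | zero  = refl
... | suc m = contradiction
  (ℕ.≤-trans (many (part l) (suc c) positive) (finiteSum l (suc c)))
  (ℕ.<⇒≱ (ℕ.s≤s b≤c))
  where
  positive : ∀ i → i ℕ.< suc c → 1 ℕ.≤ part l i
  positive i (ℕ.s≤s i≤c) = ℕ.≤-trans
    (subst (1 ℕ.≤_) (sym eq) (ℕ.s≤s ℕ.z≤n)) (part-antitone l i≤c)

  many : ∀ (f : ℕ → ℕ) n → (∀ i → i ℕ.< n → 1 ℕ.≤ f i) →
         n ℕ.≤ sum (applyUpTo f n)
  many f zero    h = ℕ.z≤n
  many f (suc n) h = ℕ.+-mono-≤ (h 0 (ℕ.s≤s ℕ.z≤n))
    (many (f ∘ suc) n (λ i i<n → h (suc i) (ℕ.s≤s i<n)))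

-- Arm + leg + 1 for the cell in row r and column c (both from 0); the
-- truncated subtractions are exact on cells of the diagram, i.e. c < part r.

hook : Partition → ℕ → ℕ → ℕ
hook l r c = (part l r ℕ.∸ suc c) ℕ.+ (conjugate l c ℕ.∸ suc r) ℕ.+ 1

Core : ℕ → Pred Partition 0ℓ
Core t l = ∀ r c → c ℕ.< part l r → hook l r c ≢ t

SelfConjugateCore : ℕ → Pred Partition 0ℓ
SelfConjugateCore t = Core t ∩ SelfConjugate

------------------------------------------------------------------------
-- Beta-sets

β : Partition → ℕ → ℤ
β l i = + part l i - + suc i

BetaSet : Partition → Pred ℤ 0ℓ
BetaSet l x = ∃ λ i → x ≡ β l i

infix 4 _≡_mod_

_≡_mod_ : ℤ → ℤ → ℕ → Set
x ≡ y mod t = + t ∣ x - y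

IsMaximum : Pred ℤ 0ℓ → ℤ → Set
IsMaximum P m = m ∈ P × (∀ x → x ∈ P → x ≤ m)

BetaClass : (t : ℕ) → Partition → ℤ → Pred ℤ 0ℓ
BetaClass t l i = BetaSet l ∩ (_≡ i mod t)

least : {P : Pred ℕ 0ℓ} → Decidable P → ∀ n → P n →
        ∃ λ m → P m × (∀ k → P k → m ℕ.≤ k)
least P? n pn with P? 0
least P? n       pn | yes p0 = 0 , p0 , λ _ _ → ℕ.z≤n
least P? zero    pn | no ¬p0 = contradiction pn ¬p0
least {P} P? (suc n) pn | no ¬p0 with least (P? ∘ suc) n pn
... | m , pm , min = suc m , pm , above
  where
  above : ∀ k → P k → suc m ℕ.≤ k
  above zero    p0 = contradiction p0 ¬p0
  above (suc k) pk = ℕ.s≤s (min k pk)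

betaMax : ∀ t .{{_ : NonZero t}} l i → ∃ (IsMaximum (BetaClass t l i))
betaMax t l i = β l m , ((m , refl) , pm) , max
  where
  open import Data.Integer.Divisibility.Signed using (_∣?_)

  y = - i - 1ℤ - + bound l
  j = bound l ℕ.+ y %ℕ t

  β-antitone : ∀ {a b} → a ℕ.≤ b → β l b ≤ β l a
  β-antitone a≤b = ℤ.+-mono-≤ (ℤ.+≤+ (part-antitone l a≤b))
    (ℤ.neg-mono-≤ (ℤ.+≤+ (ℕ.s≤s a≤b)))

  rearrange : ∀ i b r → 0ℤ - (1ℤ + (b + r)) - i ≡ (- i - 1ℤ - b) - r
  rearrange = solve-∀

  cancel : ∀ r q → (r + q) - r ≡ q
  cancel = solve-∀

  βj≡i : β l j ≡ i mod t
  βj≡i = divides (y /ℕ t) (begin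
    β l j - i
      ≡⟨ cong (λ p → + p - + suc j - i)
              (part-vanishes l j (ℕ.m≤m+n (bound l) _)) ⟩
    0ℤ - (1ℤ + (+ bound l + + (y %ℕ t))) - i
      ≡⟨ rearrange i (+ bound l) (+ (y %ℕ t)) ⟩
    y - + (y %ℕ t)
      ≡⟨ cong (_- + (y %ℕ t)) (a≡a%ℕn+[a/ℕn]*n y t) ⟩
    (+ (y %ℕ t) + (y /ℕ t) * + t) - + (y %ℕ t)
      ≡⟨ cancel (+ (y %ℕ t)) ((y /ℕ t) * + t) ⟩
    (y /ℕ t) * + t ∎)
    where open ≡-Reasoning

  first = least (λ n → + t ∣? (β l n - i)) j βj≡i
  m     = proj₁ first
  pm    = proj₁ (proj₂ first)

  max : ∀ x → x ∈ BetaClass t l i → x ≤ β l m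
  max x ((n , refl) , pn) = β-antitone (proj₂ (proj₂ first) n pn)

------------------------------------------------------------------------
-- Integer points with coordinates indexed by ℤ/tℤ

Point : ℕ → Set
Point n = Fin n → ℤ

Points : ℕ → Setoid 0ℓ 0ℓ
Points n = Fin n →-setoid ℤ

infix 9 _[_]

_[_] : ∀ {t} .{{_ : NonZero t}} → Point t → ℤ → ℤ
_[_] {t} p i = p (fromℕ< (n%ℕd<d i t))

-- `Bijects A B f P Q`: f restricts to a bijection from P to Q.

record Bijects (A B : Setoid 0ℓ 0ℓ) (f : Setoid.Carrier A → Setoid.Carrier B)
               (P : Pred (Setoid.Carrier A) 0ℓ)
               (Q : Pred (Setoid.Carrier B) 0ℓ) : Set where
  field
    maps        : ∀ {x} → P x → Q (f x)
    isBijection : IsBijection {A = ∃ P} (Setoid._≈_ A on proj₁)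
                    {B = ∃ Q} (Setoid._≈_ B on proj₁)
                    (Product.map f maps)

------------------------------------------------------------------------
-- Changes of coordinates

aCoords : ∀ t .{{_ : NonZero t}} → Partition → Point t
aCoords t l i = + t + proj₁ (betaMax t l (+ toℕ i))

-- (s + 1)(t - 1) is even when s and t are coprime, so this is exact.

shift : ℕ → ℕ → ℕ
shift s t = ⌊ suc s ℕ.* (t ℕ.∸ 1) /2⌋

zNumerator : ∀ s {t} .{{_ : NonZero t}} → Point t → ℤ → ℤ
zNumerator s {t} a j = a [ + s * j + k ] - (a [ + s * (j + 1ℤ) + k ] - + s)
  where k = + shift s t

-- `_/ℕ_` rounds down; divisibility of the numerator is asserted separately.

aToZ : ∀ s {t} .{{_ : NonZero t}} → Point t → Point t
aToZ s {t} a j = zNumerator s a (+ toℕ j) /ℕ t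

-- The index `suc i` runs over 1, …, t'.  The halving of z_{t'} (for t even)
-- is exact where it matters; this too is asserted separately.

zToU : ∀ {t} .{{_ : NonZero t}} → Point t → Point (suc ⌊ t /2⌋)
zToU     z zero    = z [ 0ℤ ] /ℕ 2
zToU {t} z (suc i) =
  if does (2 ℕ.∣? t) ∧ does (r ℕ.≟ ⌊ t /2⌋) then z [ + r ] /ℕ 2 else z [ + r ]
  where r = suc (toℕ i)

------------------------------------------------------------------------
-- The parameterizing sets

module _ (t : ℕ) .{{_ : NonZero t}} where

  Residues : Pred (Point t) 0ℓ
  Residues a = ∀ i → a [ i ] ≡ i mod t

  SumBinomial : Pred (Point t) 0ℓ
  SumBinomial a = ∑ a ≡ + (t C 2)

  ASymmetric : Pred (Point t) 0ℓ
  ASymmetric a = ∀ i → a [ i ] + a [ -1ℤ - i ] ≡ + t - 1ℤ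

  CoreInequalities : ℕ → Pred (Point t) 0ℓ
  CoreInequalities s a = ∀ i → a [ i + + s ] - + s ≤ a [ i ]

  A : ℕ → Pred (Point t) 0ℓ
  A s = CoreInequalities s ∩ Residues ∩ SumBinomial

  B : ℕ → Pred (Point t) 0ℓ
  B s = A s ∩ ASymmetric

  BAll : Pred (Point t) 0ℓ
  BAll = SumBinomial ∩ Residues ∩ ASymmetric

  ZSymmetric : Pred (Point t) 0ℓ
  ZSymmetric z = ∀ i → z [ i ] ≡ z [ - i ]

  WeightedSum : Pred (Point t) 0ℓ
  WeightedSum z = ∑ (λ i → + toℕ i * z i) ≡ 0ℤ mod t

SumsTo : ∀ {n} → ℕ → Pred (Point n) 0ℓ
SumsTo s p = ∑ p ≡ + s

NonNegative : ∀ {n} → Pred (Point n) 0ℓ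
NonNegative p = ∀ i → 0ℤ ≤ p i

module _ (t : ℕ) .{{_ : NonZero t}} (s : ℕ) where

  TD : Pred (Point t) 0ℓ
  TD = NonNegative ∩ SumsTo s ∩ WeightedSum t

  U : Pred (Point t) 0ℓ
  U = TD ∩ ZSymmetric t

  UAll : Pred (Point t) 0ℓ
  UAll = SumsTo s ∩ WeightedSum t ∩ ZSymmetric t

  V : Pred (Point (suc ⌊ t /2⌋)) 0ℓ
  V = NonNegative ∩ SumsTo ⌊ s /2⌋

  VAll : Pred (Point (suc ⌊ t /2⌋)) 0ℓ
  VAll = SumsTo ⌊ s /2⌋

{-# OPTIONS --safe #-}

-- A partition is determined by its beta-set B, the hooks are the positive
-- differences between elements of B and elements of its complement, and the
-- beta-set of the conjugate is {-1 - x : x ∉ B}.  So t-cores correspond to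
-- B - t ⊆ B, and self-conjugate partitions to sets B that contain exactly one of
-- x and -1 - x for every x.  On the maxima of B in the residue classes these
-- become B = {x : x + t ≤ a_x} and a_i + a_{-1-i} = t - 1.
--
-- The a-coordinates, read along j ↦ sj + k as g_j, form a closed walk with
-- g_j - g_{j+1} = t z_j - s, and the symmetry becomes g_j + g_{1-j} = t - 1.  The
-- steps of the walk are therefore symmetric, and they determine the walk because
-- g_0 + g_1 = t - 1.  A symmetric z is given by its values at 0, …, t', and
-- s - z_0 is twice the sum of the u_i with i ≥ 1.

module Submission where

import Data.Integer.Properties as ℤ
open import Algebra.Properties.CommutativeMonoid.Sum ℤ.+-0-commutativeMonoid
  using (sum-cong-≗; sum-permute; ∑-distrib-+)
open import Defs
open import Data.Bool.Base using (_∧_; if_then_else_)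
open import Data.Empty using (⊥; ⊥-elim)
open import Data.Fin.Base as Fin using (Fin; zero; suc; toℕ; fromℕ<)
import Data.Fin.Permutation as Perm
import Data.Fin.Properties as Fin
open import Data.Integer.Base as ℤ
  using (ℤ; +_; 0ℤ; 1ℤ; -1ℤ; -_; _+_; _-_; _*_; _≤_; ∣_∣; _/ℕ_; _%ℕ_)
open import Data.Integer.DivMod using (n%ℕd<d; a≡a%ℕn+[a/ℕn]*n; 0≤n⇒0≤n/ℕd)
open import Data.Integer.Divisibility.Signed
  using (_∣_; divides; ∣m∣n⇒∣m+n; ∣m⇒∣-m; ∣n⇒∣m*n)
open import Data.Integer.Tactic.RingSolver using (solve-∀)
open import Data.List.Base using (applyUpTo; filter; length)
open import Data.Nat.Base as ℕ using (ℕ; zero; suc; NonZero; ⌊_/2⌋)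
open import Data.Nat.Combinatorics using (_C_; nC1≡n; nCk+nC[k+1]≡[n+1]C[k+1])
open import Data.Nat.Coprimality using (Coprime; coprime-Bézout)
open import Data.Nat.GCD using (module Bézout)
import Data.Nat.Divisibility as ℕ
open import Data.Nat.Induction using (<-rec)
open import Data.Nat.ListAction using (sum)
import Data.Nat.Properties as ℕ
open import Data.Product.Base as Product using (∃; _×_; _,_; proj₁; proj₂)
open import Data.Sum.Base as Sum using (_⊎_; inj₁; inj₂; [_,_]′)
open import Function.Base using (_∘_; id)
open import Function.Construct.Composition using (isBijection)
open import Function.Structures using (IsBijection)
open import Level using (0ℓ)
open import Relation.Binary.Bundles using (Setoid)
import Relation.Binary.Construct.On as On
open import Relation.Binary.PropositionalEquality hiding ([_])
open import Relation.Nullary using (¬_; Dec; does; yes; no; contradiction)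
open import Relation.Unary using (Pred; Decidable; _∈_; _∩_)

-- Linear arithmetic over ℤ: the goal is a combination of the hypotheses, and
-- the combination is checked as an identity between differences.

-- Part (1) is cut out of part (2). Under the successive coordinate maps, being an s-core turns into
-- a_i ≥ a_{i+s} - s, then z_j ≥ 0, then u_i ≥ 0. Each bijection is therefore built once, for all
-- self-conjugate t-cores, and then restricted.
--
-- A set of integers that is bounded above and contains all sufficiently small integers is in
-- general only a translate of a beta-set. Self-duality removes the translation: the set meets each
-- pair {x, -1 - x} exactly once, and pigeonhole arguments on these pairs show that the resulting
-- parts are nonnegative and eventually zero.
--
-- The offset k = (s + 1)(t - 1)/2 satisfies 2k + 1 = t(s + 1) - s, which places the symmetry of the
-- walk so that the symmetry of z is centred at 0.
--
-- The condition ∑ j z_j ≡ 0 acts twice. It gives the starting value of the reconstructed walk the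
-- residue k, and for even t it forces s - z_0, hence z_{t'}, to be even, so that halving the middle
-- coordinate is exact.

≤-by : ∀ {x y a b} → x ≤ y → y - x ≡ b - a → a ≤ b
≤-by p e = ℤ.0≤i-j⇒j≤i (subst (0ℤ ≤_) e (ℤ.i≤j⇒0≤j-i p))

≤-by₂ : ∀ {x y u v a b} → x ≤ y → u ≤ v → (y - x) + (v - u) ≡ b - a → a ≤ b
≤-by₂ p q e = ℤ.0≤i-j⇒j≤i
  (subst (0ℤ ≤_) e (ℤ.+-mono-≤ (ℤ.i≤j⇒0≤j-i p) (ℤ.i≤j⇒0≤j-i q)))

≡-by : ∀ {x y a b} → x ≡ y → x - y ≡ a - b → a ≡ b
≡-by p e = ℤ.i-j≡0⇒i≡j _ _ (trans (sym e) (ℤ.i≡j⇒i-j≡0 p))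

≡-by₂ : ∀ {x y u v a b} → x ≡ y → u ≡ v → (x - y) + (u - v) ≡ a - b → a ≡ b
≡-by₂ p q e = ℤ.i-j≡0⇒i≡j _ _
  (trans (sym e) (cong₂ _+_ (ℤ.i≡j⇒i-j≡0 p) (ℤ.i≡j⇒i-j≡0 q)))

≰-by : ∀ {x y} → x ≤ y → y - x ≡ -1ℤ → ⊥
≰-by p e with subst (0ℤ ≤_) e (ℤ.i≤j⇒0≤j-i p)
... | ()

≰⇒1+≤ : ∀ {x y} → ¬ x ≤ y → 1ℤ + y ≤ x
≰⇒1+≤ = ℤ.i<j⇒suc[i]≤j ∘ ℤ.≰⇒>

i≤+∣i∣ : ∀ i → i ≤ + ∣ i ∣
i≤+∣i∣ (+ n)      = ℤ.≤-refl
i≤+∣i∣ ℤ.-[1+ n ] = ℤ.-≤+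

-- Congruences

-- A record because x and y cannot be inferred from `x ≡ y mod t`, which unfolds
-- to a statement about x - y.
record _≈_mod_ (x y : ℤ) (t : ℕ) : Set where
  constructor mod
  field unmod : x ≡ y mod t

open _≈_mod_

infix 4 _≈_mod_

module _ {t : ℕ} where

  mod-reflexive : ∀ {x y} → x ≡ y → x ≈ y mod t
  mod-reflexive {x} refl = mod (divides 0ℤ (ℤ.+-inverseʳ x))

  mod-sym : ∀ {x y} → x ≈ y mod t → y ≈ x mod t
  mod-sym {x} {y} (mod p) = mod (subst (+ t ∣_) (eq x y) (∣m⇒∣-m p))
    where
    eq : ∀ x y → - (x - y) ≡ y - x
    eq = solve-∀

  mod-trans : ∀ {x y z} → x ≈ y mod t → y ≈ z mod t → x ≈ z mod t
  mod-trans {x} {y} {z} (mod p) (mod q) = mod (subst (+ t ∣_) (eq x y z) (∣m∣n⇒∣m+n p q))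
    where
    eq : ∀ x y z → (x - y) + (y - z) ≡ x - z
    eq = solve-∀

  mod-+ : ∀ {x x′ y y′} → x ≈ x′ mod t → y ≈ y′ mod t → x + y ≈ x′ + y′ mod t
  mod-+ {x} {x′} {y} {y′} (mod p) (mod q) =
    mod (subst (+ t ∣_) (eq x x′ y y′) (∣m∣n⇒∣m+n p q))
    where
    eq : ∀ x x′ y y′ → (x - x′) + (y - y′) ≡ (x + y) - (x′ + y′)
    eq = solve-∀

  mod-* : ∀ c {x y} → x ≈ y mod t → c * x ≈ c * y mod t
  mod-* c {x} {y} (mod p) = mod (subst (+ t ∣_) (eq c x y) (∣n⇒∣m*n c p))
    where
    eq : ∀ c x y → c * (x - y) ≡ c * x - c * y
    eq = solve-∀

  mod-neg : ∀ {x y} → x ≈ y mod t → - x ≈ - y mod t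
  mod-neg {x} {y} (mod p) = mod (subst (+ t ∣_) (eq x y) (∣m⇒∣-m p))
    where
    eq : ∀ x y → - (x - y) ≡ - x - - y
    eq = solve-∀

  mod-shift : ∀ x q → x + q * + t ≈ x mod t
  mod-shift x q = mod (divides q (eq x (q * + t)))
    where
    eq : ∀ x y → (x + y) - x ≡ y
    eq = solve-∀

  -- The quotient of x - y by t is at most 0 or at least 1. This turns the failure of `y + t ≤ x`
  -- into `x ≤ y`.
  mod-gap : ∀ {x y} → x ≈ y mod t → x ≤ y ⊎ y + + t ≤ x
  mod-gap {x} {y} (mod (divides q e)) with q ℤ.≤? 0ℤ
  ... | yes q≤0 = inj₁ (≤-by (ℤ.*-monoʳ-≤-nonNeg (+ t) q≤0)
    (trans (cong (λ z → 0ℤ * + t - z) (sym e)) (eq x y (+ t))))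
    where
    eq : ∀ x y t → 0ℤ * t - (x - y) ≡ y - x
    eq = solve-∀
  ... | no q≰0 = inj₂ (≤-by (ℤ.*-monoʳ-≤-nonNeg (+ t) (≰⇒1+≤ q≰0))
    (trans (cong (_- 1ℤ * + t) (sym e)) (eq x y (+ t))))
    where
    eq : ∀ x y t → (x - y) - 1ℤ * t ≡ x - (y + t)
    eq = solve-∀

module _ {t : ℕ} .{{_ : NonZero t}} where

  mod-% : ∀ i → + (i %ℕ t) ≈ i mod t
  mod-% i = subst (+ (i %ℕ t) ≈_mod t) (sym (a≡a%ℕn+[a/ℕn]*n i t))
    (mod-sym (mod-shift (+ (i %ℕ t)) (i /ℕ t)))

  mod-small : ∀ {m n} → m ℕ.< t → + m ≈ + n mod t → m ℕ.≤ n
  mod-small m<t p with mod-gap p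
  ... | inj₁ (ℤ.+≤+ m≤n) = m≤n
  ... | inj₂ (ℤ.+≤+ n+t≤m) =
    contradiction (ℕ.≤-trans (ℕ.m≤n+m t _) n+t≤m) (ℕ.<⇒≱ m<t)

  mod-unique : ∀ {m n} → m ℕ.< t → n ℕ.< t → + m ≈ + n mod t → m ≡ n
  mod-unique m<t n<t p =
    ℕ.≤-antisym (mod-small m<t p) (mod-small n<t (mod-sym p))

  %-cong : ∀ {i j} → i ≈ j mod t → i %ℕ t ≡ j %ℕ t
  %-cong {i} {j} p = mod-unique (n%ℕd<d i t) (n%ℕd<d j t)
    (mod-trans (mod-% i) (mod-trans p (mod-sym (mod-% j))))

  %-small : ∀ {n} → n ℕ.< t → + n %ℕ t ≡ n
  %-small {n} n<t = mod-unique (n%ℕd<d (+ n) t) n<t (mod-% (+ n))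

  []-cong : ∀ (p : Point t) {i j} → i ≈ j mod t → p [ i ] ≡ p [ j ]
  []-cong p i≡j = cong p (Fin.fromℕ<-cong _ _ (%-cong i≡j) _ _)

  []-toℕ : ∀ (p : Point t) i → p [ + toℕ i ] ≡ p i
  []-toℕ p i = cong p (trans
    (Fin.fromℕ<-cong _ _ (%-small (Fin.toℕ<n i)) _ (Fin.toℕ<n i))
    (Fin.fromℕ<-toℕ i _))

  []-ext : ∀ {p q : Point t} → (∀ i → p i ≡ q i) → ∀ i → p [ i ] ≡ q [ i ]
  []-ext p≗q i = p≗q _

  Periodic : Pred (ℤ → ℤ) 0ℓ
  Periodic f = ∀ {i j} → i ≈ j mod t → f i ≡ f j

  []-tabulate : ∀ {f} → Periodic f → ∀ i → (λ k → f (+ toℕ k)) [ i ] ≡ f i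
  []-tabulate {f} per i = trans
    (cong (f ∘ +_) (Fin.toℕ-fromℕ< (n%ℕd<d i t))) (per (mod-% i))

  ext-[] : ∀ {p q : Point t} → (∀ i → p [ i ] ≡ q [ i ]) → ∀ i → p i ≡ q i
  ext-[] {p} {q} e i =
    trans (sym ([]-toℕ p i)) (trans (e (+ toℕ i)) ([]-toℕ q i))

-- The conjugate partition

module _ {P : Pred ℕ 0ℓ} (P? : Decidable P) where

  -- `upTo` is the case `f = id`; the recursion passes to `f ∘ suc`, so f has to vary.
  count : (ℕ → ℕ) → ℕ → ℕ
  count f n = length (filter P? (applyUpTo f n))

  -- A downward closed predicate holds on an initial segment, so its count is the length of that
  -- segment.
  count⁻ : ∀ f → (∀ k → P (f (suc k)) → P (f k)) →
           ∀ n k → k ℕ.< count f n → P (f k)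
  count⁻ f down (suc n) k k< with P? (f 0)
  count⁻ f down (suc n) zero    k< | yes p = p
  count⁻ f down (suc n) (suc k) (ℕ.s≤s k<) | yes p =
    count⁻ (f ∘ suc) (down ∘ suc) n k k<
  ... | no ¬p =
    down k (count⁻ (f ∘ suc) (down ∘ suc) n k k<)

  count⁺ : ∀ f → (∀ k → P (f (suc k)) → P (f k)) →
           ∀ n k → k ℕ.< n → P (f k) → k ℕ.< count f n
  count⁺ f down (suc n) k k<n pk with P? (f 0)
  count⁺ f down (suc n) zero    k<n pk | yes p = ℕ.s≤s ℕ.z≤n
  count⁺ f down (suc n) (suc k) (ℕ.s≤s k<n) pk | yes p =
    ℕ.s≤s (count⁺ (f ∘ suc) (down ∘ suc) n k k<n pk)
  ... | no ¬p = contradiction (to-0 k pk) ¬p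
    where
    to-0 : ∀ k → P (f k) → P (f 0)
    to-0 zero    p = p
    to-0 (suc k) p = to-0 k (down k p)

module _ (l : Partition) where

  -- Transposition of the diagram: either inequality says that row r and column c meet in a cell.
  <conjugate⇒<part : ∀ r c → r ℕ.< conjugate l c → c ℕ.< part l r
  <conjugate⇒<part r c = count⁻ (λ r → c ℕ.<? part l r) id
    (λ k c< → ℕ.≤-trans c< (decreasing l k)) (bound l) r

  <part⇒<conjugate : ∀ r c → c ℕ.< part l r → r ℕ.< conjugate l c
  <part⇒<conjugate r c c< = count⁺ (λ r → c ℕ.<? part l r) id
    (λ k c< → ℕ.≤-trans c< (decreasing l k)) (bound l) r
    (ℕ.≰⇒> λ b≤r → contradiction
      (subst (c ℕ.<_) (part-vanishes l r b≤r) c<) λ ()) c<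

  ≤part⇒conjugate≤ : ∀ r c → part l r ℕ.≤ c → conjugate l c ℕ.≤ r
  ≤part⇒conjugate≤ r c p≤c =
    ℕ.≮⇒≥ (ℕ.≤⇒≯ p≤c ∘ <conjugate⇒<part r c)

  conjugate-decreasing : ∀ c → conjugate l (suc c) ℕ.≤ conjugate l c
  conjugate-decreasing c = ≤part⇒conjugate≤ (conjugate l c) (suc c)
    (ℕ.m≤n⇒m≤1+n (ℕ.≮⇒≥ (ℕ.n≮n _ ∘ <part⇒<conjugate (conjugate l c) c)))

-- Strictly decreasing sequences

StrictlyDecreasing : Pred (ℕ → ℤ) 0ℓ
StrictlyDecreasing f = ∀ n → 1ℤ + f (suc n) ≤ f n

module _ {f : ℕ → ℤ} (f↓ : StrictlyDecreasing f) where

  decreasing-< : ∀ {m n} → m ℕ.< n → 1ℤ + f n ≤ f m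
  decreasing-< m<n = go (ℕ.≤⇒≤′ m<n)
    where
    go : ∀ {m n} → suc m ℕ.≤′ n → 1ℤ + f n ≤ f m
    go ℕ.≤′-refl = f↓ _
    go (ℕ.≤′-step p) =
      ℤ.≤-trans (f↓ _) (ℤ.≤-trans (ℤ.i≤suc[i] _) (go p))

  decreasing-≤ : ∀ {m n} → m ℕ.≤ n → f n ≤ f m
  decreasing-≤ m≤n with ℕ.m≤n⇒m<n∨m≡n m≤n
  ... | inj₁ m<n = ℤ.≤-trans (ℤ.i≤suc[i] _) (decreasing-< m<n)
  ... | inj₂ refl = ℤ.≤-refl

  decreasing-linear : ∀ n → f n + + n ≤ f 0
  decreasing-linear zero = ℤ.≤-reflexive (ℤ.+-identityʳ (f 0))
  decreasing-linear (suc n) =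
    ≤-by₂ (decreasing-linear n) (f↓ n) (eq (f 0) (f n) (f (suc n)) (+ n))
    where
    eq : ∀ a b c n → (a - (b + n)) + (b - (1ℤ + c)) ≡ a - (c + (1ℤ + n))
    eq = solve-∀

  decreasing-cancel-≤ : ∀ {m n} → f n ≤ f m → m ℕ.≤ n
  decreasing-cancel-≤ {m} {n} fn≤fm = ℕ.≮⇒≥ λ n<m →
    ≰-by (ℤ.≤-trans (decreasing-< n<m) fn≤fm) (eq (f m))
    where
    eq : ∀ x → x - (1ℤ + x) ≡ -1ℤ
    eq = solve-∀

  decreasing-injective : ∀ {m n} → f m ≡ f n → m ≡ n
  decreasing-injective e = ℕ.≤-antisym
    (decreasing-cancel-≤ (ℤ.≤-reflexive (sym e)))
    (decreasing-cancel-≤ (ℤ.≤-reflexive e))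

  -- Every step loses at least 1. The explicit index is what the searches by `least` start from.
  decreasing-unbounded : ∀ x → f ∣ f 0 - x ∣ ≤ x
  decreasing-unbounded x = ≤-by₂ (decreasing-linear b) (i≤+∣i∣ (f 0 - x))
    (eq (f 0) (f b) (+ b) x)
    where
    b : ℕ
    b = ∣ f 0 - x ∣
    eq : ∀ b₀ b n x → (b₀ - (b + n)) + (n - (b₀ - x)) ≡ x - b
    eq = solve-∀

Range : (ℕ → ℤ) → Pred ℤ 0ℓ
Range f x = ∃ λ n → x ≡ f n

-- Let f n = g m. If m < n, then g m = f m by agreement, and f would take one value twice; so n ≤ m,
-- and g decreases.
range-≤ : ∀ {f g} → StrictlyDecreasing f → StrictlyDecreasing g →
          (∀ n → Range g (f n)) → ∀ n →
          (∀ {m} → m ℕ.< n → f m ≡ g m) → f n ≤ g n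
range-≤ {f} {g} f↓ g↓ f⊆g n agree with f⊆g n
... | m , e with n ℕ.≤? m
...   | yes n≤m = subst (_≤ g n) (sym e) (decreasing-≤ g↓ n≤m)
...   | no n≰m = contradiction
        (decreasing-injective f↓ (trans (agree (ℕ.≰⇒> n≰m)) (sym e)))
        (ℕ.<⇒≢ (ℕ.≰⇒> n≰m))

range-unique : ∀ {f g} → StrictlyDecreasing f → StrictlyDecreasing g →
               (∀ n → Range g (f n)) → (∀ n → Range f (g n)) →
               ∀ n → f n ≡ g n
range-unique f↓ g↓ f⊆g g⊆f = <-rec _ λ n agree → ℤ.≤-antisym
  (range-≤ f↓ g↓ f⊆g n agree)
  (range-≤ g↓ f↓ g⊆f n (sym ∘ agree))

-- Beta-sets

β-decreasing : ∀ l → StrictlyDecreasing (β l)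
β-decreasing l n = ≤-by (ℤ.+≤+ (decreasing l n))
  (eq (+ part l n) (+ part l (suc n)) (+ n))
  where
  eq : ∀ a b n → a - b ≡ (a - (1ℤ + n)) - (1ℤ + (b - (1ℤ + (1ℤ + n))))
  eq = solve-∀

-- The gaps of the beta-set in increasing order, one for each column. Along the boundary of the
-- diagram, `β` labels the vertical steps and `γ` the horizontal ones.
γ : Partition → ℕ → ℤ
γ l c = + c - + conjugate l c

β-<-γ : ∀ l r c → part l r ℕ.≤ c → 1ℤ + β l r ≤ γ l c
β-<-γ l r c p≤c = ≤-by₂ (ℤ.+≤+ p≤c) (ℤ.+≤+ (≤part⇒conjugate≤ l r c p≤c))
  (eq (+ part l r) (+ c) (+ conjugate l c) (+ r))
  where
  eq : ∀ p c q r → (c - p) + (r - q) ≡ (c - q) - (1ℤ + (p - (1ℤ + r)))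
  eq = solve-∀

γ-<-β : ∀ l r c → c ℕ.< part l r → 1ℤ + γ l c ≤ β l r
γ-<-β l r c c<p = ≤-by₂ (ℤ.+≤+ c<p) (ℤ.+≤+ (<part⇒<conjugate l r c c<p))
  (eq (+ part l r) (+ c) (+ conjugate l c) (+ r))
  where
  eq : ∀ p c q r → (p - (1ℤ + c)) + (q - (1ℤ + r)) ≡
                   (p - (1ℤ + r)) - (1ℤ + (c - q))
  eq = solve-∀

1+x≰x : ∀ {x} → ¬ 1ℤ + x ≤ x
1+x≰x {x} p = ≰-by p (eq x)
  where
  eq : ∀ x → x - (1ℤ + x) ≡ -1ℤ
  eq = solve-∀

γ∉BetaSet : ∀ l c → ¬ BetaSet l (γ l c)
γ∉BetaSet l c (r , e) with part l r ℕ.≤? c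
... | yes p≤c = 1+x≰x (subst (1ℤ + β l r ≤_) e (β-<-γ l r c p≤c))
... | no p≰c  =
  1+x≰x (subst (λ x → 1ℤ + x ≤ β l r) e (γ-<-β l r c (ℕ.≰⇒> p≰c)))

-- Let r be the first row with `β l r ≤ x`. If equality fails, x lies strictly between two
-- consecutive beta-numbers (or above all of them), and then column x + r has exactly r cells.
locate : ∀ l x → BetaSet l x ⊎ ∃ λ c → x ≡ γ l c
locate l x = go
  (least (λ n → β l n ℤ.≤? x) _ (decreasing-unbounded (β-decreasing l) x))
  where
  go : (∃ λ r → β l r ≤ x × (∀ k → β l k ≤ x → r ℕ.≤ k)) → _
  go (r , βr≤x , first) with x ℤ.≟ β l r
  ... | yes e = inj₁ (r , e)
  ... | no x≢ = inj₂ (c , trans (sym (eq₂ x (+ r))) (cong₂ _-_ x+r≡c (cong +_ r≡)))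
    where
    part≤ : + part l r ≤ x + + r
    part≤ = ≤-by (ℤ.i<j⇒suc[i]≤j (ℤ.≤∧≢⇒< βr≤x (x≢ ∘ sym)))
      (eq (+ part l r) x (+ r))
      where
      eq : ∀ p x r → x - (1ℤ + (p - (1ℤ + r))) ≡ (x + r) - p
      eq = solve-∀
    c = ∣ x + + r ∣
    x+r≡c : x + + r ≡ + c
    x+r≡c = sym (ℤ.0≤i⇒+∣i∣≡i (ℤ.≤-trans (ℤ.+≤+ ℕ.z≤n) part≤))
    eq₂ : ∀ x r → (x + r) - r ≡ x
    eq₂ = solve-∀
    r≤ : r ℕ.≤ conjugate l c
    r≤ = below r refl
      where
      -- The minimality of r is applied to the preceding row, which exists only if r is positive.
      below : ∀ r′ → r ≡ r′ → r′ ℕ.≤ conjugate l c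
      below zero    _ = ℕ.z≤n
      below (suc r′) refl = <part⇒<conjugate l r′ c
        (ℤ.drop‿+≤+ (subst (λ y → 1ℤ + y ≤ + part l r′) x+r≡c
          (≤-by (≰⇒1+≤ (λ βr′≤x → ℕ.n≮n r′ (first r′ βr′≤x)))
            (eq (+ part l r′) x (+ r′)))))
        where
        eq : ∀ p x r → (p - (1ℤ + r)) - (1ℤ + x) ≡ p - (1ℤ + (x + (1ℤ + r)))
        eq = solve-∀
    r≡ : r ≡ conjugate l c
    r≡ = ℕ.≤-antisym r≤ (≤part⇒conjugate≤ l r c
      (ℤ.drop‿+≤+ (subst (+ part l r ≤_) x+r≡c part≤)))

-- Keeps `with` from unfolding the search.
abstract
  β⊎γ : ∀ l x → BetaSet l x ⊎ ∃ λ c → x ≡ γ l c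
  β⊎γ = locate

+-∸ : ∀ {m n} → n ℕ.≤ m → + (m ℕ.∸ n) ≡ + m - + n
+-∸ {m} {n} n≤m = sym (trans (ℤ.[+m]-[+n]≡m⊖n m n) (ℤ.⊖-≥ n≤m))

hook≡β-γ : ∀ l r c → c ℕ.< part l r → + hook l r c ≡ β l r - γ l c
hook≡β-γ l r c c<p = trans
  (cong₂ (λ x y → x + y + 1ℤ) (+-∸ c<p) (+-∸ (<part⇒<conjugate l r c c<p)))
  (eq (+ part l r) (+ c) (+ conjugate l c) (+ r))
  where
  eq : ∀ p c q r → (p - (1ℤ + c)) + (q - (1ℤ + r)) + 1ℤ ≡
                   (p - (1ℤ + r)) - (c - q)
  eq = solve-∀

ClosedUnder : ℕ → Pred (Pred ℤ 0ℓ) 0ℓ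
ClosedUnder t P = ∀ {x} → P x → P (x - + t)

-- If `β l r - t` were missing, it would be some `γ l c`. Where row r and column c meet, the hook
-- would have length t; where they do not, β_r < γ_c = β_r - t is absurd.
core⇒closed : ∀ {t} .{{_ : NonZero t}} {l} → Core t l → ClosedUnder t (BetaSet l)
core⇒closed {t} {l} core (r , refl) with β⊎γ l (β l r - + t)
... | inj₁ β-t∈B   = β-t∈B
... | inj₂ (c , e) with part l r ℕ.≤? c
...   | no p≰c  = contradiction
        (ℤ.+-injective (trans (hook≡β-γ l r c (ℕ.≰⇒> p≰c))
          (trans (cong (λ y → β l r - y) (sym e)) (eq (β l r) (+ t)))))
        (core r c (ℕ.≰⇒> p≰c))
  where
  eq : ∀ x t → x - (x - t) ≡ t
  eq = solve-∀
...   | yes p≤c = ⊥-elim (ℕ.<⇒≱ (ℕ.>-nonZero⁻¹ t) (ℕ.<⇒≤ (ℤ.drop‿+≤+ 1+t≤0)))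
  where
  eq : ∀ x t → (x - t) - (1ℤ + x) ≡ 0ℤ - (1ℤ + t)
  eq = solve-∀
  1+t≤0 : 1ℤ + + t ≤ 0ℤ
  1+t≤0 = ≤-by (subst (1ℤ + β l r ≤_) (sym e) (β-<-γ l r c p≤c)) (eq (β l r) (+ t))

closed⇒core : ∀ {t l} → ClosedUnder t (BetaSet l) → Core t l
closed⇒core {t} {l} closed r c c<p hook≡t = γ∉BetaSet l c
  (subst (BetaSet l) (≡-by (trans (sym (hook≡β-γ l r c c<p)) (cong +_ hook≡t))
    (eq (β l r) (γ l c) (+ t))) (closed (r , refl)))
  where
  eq : ∀ x y t → (x - y) - t ≡ (x - t) - y
  eq = solve-∀

-- x ∈ P if and only if -1 - x ∉ P, in a form that also decides P.

SelfDual : Pred (Pred ℤ 0ℓ) 0ℓ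
SelfDual P = ∀ x → (P x × ¬ P (-1ℤ - x)) ⊎ (¬ P x × P (-1ℤ - x))

selfDual-∈ : ∀ {P} → SelfDual P → ∀ {x} → P x → ¬ P (-1ℤ - x)
selfDual-∈ dual {x} px = [ proj₂ , (λ (¬px , _) → contradiction px ¬px) ]′ (dual x)

selfDual-∉ : ∀ {P} → SelfDual P → ∀ {x} → ¬ P x → P (-1ℤ - x)
selfDual-∉ dual {x} ¬px = [ (λ (px , _) → contradiction px ¬px) , proj₂ ]′ (dual x)

module _ {l : Partition} where

  private
    ∉⇒γ : ∀ {x} → ¬ BetaSet l x → ∃ λ c → x ≡ γ l c
    ∉⇒γ {x} x∉ = [ (λ x∈ → contradiction x∈ x∉) , id ]′ (β⊎γ l x)

    -1-β : ∀ c → part l c ≡ conjugate l c → -1ℤ - β l c ≡ γ l c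
    -1-β c e = trans (eq (+ part l c) (+ c)) (cong (λ m → + c - + m) e)
      where
      eq : ∀ p c → -1ℤ - (p - (1ℤ + c)) ≡ c - p
      eq = solve-∀

    -1-γ : ∀ c → part l c ≡ conjugate l c → -1ℤ - γ l c ≡ β l c
    -1-γ c e = trans (eq (+ conjugate l c) (+ c))
      (cong (λ m → + m - + suc c) (sym e))
      where
      eq : ∀ q c → -1ℤ - (c - q) ≡ q - (1ℤ + c)
      eq = solve-∀

  selfConjugate⇒selfDual : SelfConjugate l → SelfDual (BetaSet l)
  selfConjugate⇒selfDual sc x with β⊎γ l x
  ... | inj₁ (r , refl) = inj₁ ((r , refl) ,
    γ∉BetaSet l r ∘ subst (BetaSet l) (-1-β r (sc r)))
  ... | inj₂ (c , refl) = inj₂ (γ∉BetaSet l c , c , -1-γ c (sc c))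

  -- The sequence -1 - γ_c equals λ̄_{c+1} - (c + 1), the beta-sequence of the conjugate.
  -- Self-duality gives it the same range as `β l`, and a strictly decreasing enumeration is
  -- determined by its range.
  selfDual⇒selfConjugate : SelfDual (BetaSet l) → SelfConjugate l
  selfDual⇒selfConjugate dual r = ℤ.+-injective
    (≡-by (range-unique (β-decreasing l) δ-decreasing β⊆δ δ⊆β r)
      (eq (+ part l r) (+ conjugate l r) (+ r)))
    where
    eq : ∀ p q r → (p - (1ℤ + r)) - (-1ℤ - (r - q)) ≡ p - q
    eq = solve-∀

    δ : ℕ → ℤ
    δ c = -1ℤ - γ l c

    δ-decreasing : StrictlyDecreasing δ
    δ-decreasing c = ≤-by (ℤ.+≤+ (conjugate-decreasing l c))
      (eq₁ (+ c) (+ conjugate l c) (+ conjugate l (suc c)))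
      where
      eq₁ : ∀ c q q′ → q - q′ ≡ (-1ℤ - (c - q)) - (1ℤ + (-1ℤ - ((1ℤ + c) - q′)))
      eq₁ = solve-∀

    β⊆δ : ∀ n → Range δ (β l n)
    β⊆δ n = Product.map₂ (λ {c} e → trans (eq₂ (β l n)) (cong (λ y → -1ℤ - y) e))
      (∉⇒γ (selfDual-∈ dual (n , refl)))
      where
      eq₂ : ∀ x → x ≡ -1ℤ - (-1ℤ - x)
      eq₂ = solve-∀

    δ⊆β : ∀ n → Range (β l) (δ n)
    δ⊆β n = selfDual-∉ dual (γ∉BetaSet l n)

betaSet-injective : ∀ {l m} → (∀ {x} → BetaSet l x → BetaSet m x) →
                    (∀ {x} → BetaSet m x → BetaSet l x) →
                    ∀ i → part l i ≡ part m i
betaSet-injective {l} {m} l⊆m m⊆l i = ℤ.+-injective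
  (≡-by (range-unique (β-decreasing l) (β-decreasing m)
      (λ n → l⊆m (n , refl)) (λ n → m⊆l (n , refl)) i)
    (eq (+ part l i) (+ part m i) (+ suc i)))
  where
  eq : ∀ p q r → (p - r) - (q - r) ≡ p - q
  eq = solve-∀

sum-bound : ∀ f M N → (∀ i → f i ℕ.≤ M) → (∀ i → N ℕ.≤ i → f i ≡ 0) →
            ∀ n → sum (applyUpTo f n) ℕ.≤ N ℕ.* M
sum-bound f M N       f≤M f≡0 zero    = ℕ.z≤n
sum-bound f M zero    f≤M f≡0 (suc n) = ℕ.+-mono-≤
  (ℕ.≤-reflexive (f≡0 0 ℕ.z≤n))
  (sum-bound (f ∘ suc) M zero (f≤M ∘ suc) (λ i _ → f≡0 (suc i) ℕ.z≤n) n)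
sum-bound f M (suc N) f≤M f≡0 (suc n) = ℕ.+-mono-≤ (f≤M 0)
  (sum-bound (f ∘ suc) M N (f≤M ∘ suc) (λ i → f≡0 (suc i) ∘ ℕ.s≤s) n)

-- The fibres of `fold` are the pairs {x, -1 - x}, of which a self-dual set
-- contains exactly one element each.

fold : ℤ → ℕ
fold (+ n)      = n
fold ℤ.-[1+ n ] = n

fold-injective : ∀ x y → fold x ≡ fold y → x ≡ y ⊎ -1ℤ - x ≡ y
fold-injective (+ n)      (+ .n)      refl = inj₁ refl
fold-injective (+ zero)   ℤ.-[1+ .0 ] refl = inj₂ refl
fold-injective (+ suc n)  ℤ.-[1+ _ ]  refl = inj₂ refl
fold-injective ℤ.-[1+ n ] (+ .n)      refl = inj₂ refl
fold-injective ℤ.-[1+ n ] ℤ.-[1+ .n ] refl = inj₁ refl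

fold-lower : ∀ x → - + suc (fold x) ≤ x
fold-lower (+ n)      = ℤ.-≤+
fold-lower ℤ.-[1+ n ] = ℤ.≤-refl

fold-upper : ∀ {N} x → 1ℤ + x ≤ + N → - + N ≤ x → fold x ℕ.< N
fold-upper (+ n) (ℤ.+≤+ n<N) _ = n<N
fold-upper {suc N} ℤ.-[1+ n ] _ (ℤ.-≤- n≤N) = ℕ.s≤s n≤N

-- The partition with a given beta-set

module FromBetaSet {P : Pred ℤ 0ℓ} (dual : SelfDual P) (N : ℕ)
                   (P<N : ∀ {x} → P x → 1ℤ + x ≤ + N) where

  P? : Decidable P
  P? x = [ (λ (px , _) → yes px) , (λ (¬px , _) → no ¬px) ]′ (dual x)

  -- Duality turns the upper bound into a lower one: if x were missing, -1 - x ≥ N would belong to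
  -- P.
  P-low : ∀ {x} → x ≤ - + suc N → P x
  P-low {x} x≤ with P? x
  ... | yes px = px
  ... | no ¬px = ⊥-elim (≰-by
    (ℤ.+-mono-≤ (P<N (selfDual-∉ dual ¬px)) x≤) (eq (+ N) x))
    where
    eq : ∀ n x → (n + - (1ℤ + n)) - ((1ℤ + (-1ℤ - x)) + x) ≡ -1ℤ
    eq = solve-∀

  IsPredecessor : ℤ → Pred ℤ 0ℓ
  IsPredecessor y m = P m × 1ℤ + m ≤ y × (∀ {x} → P x → 1ℤ + x ≤ y → x ≤ m)

  findPredecessor : ∀ y → ∃ (IsPredecessor y)
  findPredecessor y = y - + suc k , proj₁ (proj₂ first) , below , largest
    where
    eq₁ : ∀ y n b → b - (y + n) ≡ - (1ℤ + n) - (y - (1ℤ + b))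
    eq₁ = solve-∀
    -- The search runs down from y - 1; after ∣ y + N ∣ further steps it is at or below -(N + 1),
    -- where everything belongs to P.
    first = least (λ n → P? (y - + suc n)) ∣ y + + N ∣
      (P-low (≤-by (i≤+∣i∣ (y + + N)) (eq₁ y (+ N) (+ ∣ y + + N ∣))))
    k = proj₁ first

    eq₂ : ∀ y k → k - 0ℤ ≡ y - (1ℤ + (y - (1ℤ + k)))
    eq₂ = solve-∀
    below : 1ℤ + (y - + suc k) ≤ y
    below = ≤-by (ℤ.+≤+ {n = k} ℕ.z≤n) (eq₂ y (+ k))

    eq₃ : ∀ x y → x ≡ y - (1ℤ + (y - (1ℤ + x)))
    eq₃ = solve-∀
    eq₄ : ∀ x y k → (y - (1ℤ + x)) - k ≡ (y - (1ℤ + k)) - x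
    eq₄ = solve-∀
    largest : ∀ {x} → P x → 1ℤ + x ≤ y → x ≤ y - + suc k
    largest {x} px 1+x≤y =
      ≤-by (subst (+ k ≤_) gap (ℤ.+≤+ (proj₂ (proj₂ first) _
        (subst P (trans (eq₃ x y) (cong (λ z → y - (1ℤ + z)) (sym gap))) px))))
        (eq₄ x y (+ k))
      where
      gap : + ∣ y - (1ℤ + x) ∣ ≡ y - (1ℤ + x)
      gap = ℤ.0≤i⇒+∣i∣≡i (ℤ.i≤j⇒0≤j-i 1+x≤y)

  abstract
    predecessor : ∀ y → ∃ (IsPredecessor y)
    predecessor = findPredecessor

  mutual
    -- Greedy enumeration of P from the top. The first ceiling N lies strictly above all of P, so no
    -- element is skipped.
    element : ℕ → ℤ
    element n = proj₁ (predecessor (ceiling n))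

    ceiling : ℕ → ℤ
    ceiling zero    = + N
    ceiling (suc n) = element n

  element∈P : ∀ n → P (element n)
  element∈P n = proj₁ (proj₂ (predecessor (ceiling n)))

  element<ceiling : ∀ n → 1ℤ + element n ≤ ceiling n
  element<ceiling n = proj₁ (proj₂ (proj₂ (predecessor (ceiling n))))

  element-largest : ∀ n {x} → P x → 1ℤ + x ≤ ceiling n → x ≤ element n
  element-largest n = proj₂ (proj₂ (proj₂ (predecessor (ceiling n))))

  element-decreasing : StrictlyDecreasing element
  element-decreasing n = element<ceiling (suc n)

  -- For the first n with `element n ≤ x`, x is still below the n-th ceiling, and `element n` is the
  -- largest member of P there.
  findElement : ∀ {x} → P x → Range element x
  findElement {x} px = go (least (λ n → element n ℤ.≤? x) ∣ element 0 - x ∣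
    (decreasing-unbounded element-decreasing x))
    where
    x<ceiling : ∀ n → (∀ k → element k ≤ x → n ℕ.≤ k) → 1ℤ + x ≤ ceiling n
    x<ceiling zero    first = P<N px
    x<ceiling (suc n) first = ≰⇒1+≤ (ℕ.n≮n n ∘ first n)

    go : (∃ λ n → element n ≤ x × (∀ k → element k ≤ x → n ℕ.≤ k)) →
         Range element x
    go (n , e≤x , first) =
      n , ℤ.≤-antisym (element-largest n px (x<ceiling n first)) e≤x

  abstract
    element-surjective : ∀ {x} → P x → Range element x
    element-surjective = findElement

  representative : ∀ k → ∃ λ x → P x × fold x ≡ k
  representative k with dual (+ k)
  ... | inj₁ (pk , _)  = + k , pk , refl
  ... | inj₂ (_ , p-k) = -1ℤ - + k , p-k , fold-neg k
    where
    fold-neg : ∀ k → fold (-1ℤ - + k) ≡ k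
    fold-neg zero    = refl
    fold-neg (suc k) = refl

  fold-injective-P : ∀ {x y} → P x → P y → fold x ≡ fold y → x ≡ y
  fold-injective-P {x} {y} px py e with fold-injective x y e
  ... | inj₁ x≡y  = x≡y
  ... | inj₂ refl = contradiction py (selfDual-∈ dual px)

  -- Otherwise the i + 1 representatives x with fold x ≤ i would all lie among
  -- the first i elements.
  element-lower : ∀ i → - + suc i ≤ element i
  element-lower i with - + suc i ℤ.≤? element i
  ... | yes p = p
  ... | no ¬p = ⊥-elim (ℕ.<⇒≢ k<k′ (trans (sym (fold≡ k))
    (trans (cong fold (trans (proj₂ (index k))
      (trans (cong element (Fin.fromℕ<-injective _ _ _ _ same))
        (sym (proj₂ (index k′)))))) (fold≡ k′))))
    where
    rep : Fin (suc i) → ℤ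
    rep k = proj₁ (representative (toℕ k))
    fold≡ : ∀ k → fold (rep k) ≡ toℕ k
    fold≡ k = proj₂ (proj₂ (representative (toℕ k)))
    index : ∀ k → Range element (rep k)
    index k = element-surjective (proj₁ (proj₂ (representative (toℕ k))))
    index<i : ∀ k → proj₁ (index k) ℕ.< i
    -- With an index of i or more, `element i` would be at least `rep k`, hence at least -(i + 1).
    index<i k = ℕ.≰⇒> λ i≤n → ¬p (ℤ.≤-trans
      (ℤ.≤-trans (ℤ.neg-mono-≤ (ℤ.+≤+ (ℕ.s≤s (subst (ℕ._≤ i) (sym (fold≡ k))
        (ℕ.s≤s⁻¹ (Fin.toℕ<n k)))))) (fold-lower (rep k)))
      (subst (_≤ element i) (sym (proj₂ (index k)))
        (decreasing-≤ element-decreasing i≤n)))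
    collision = Fin.pigeonhole (ℕ.n<1+n i) (λ k → fromℕ< (index<i k))
    k    = proj₁ collision
    k′   = proj₁ (proj₂ collision)
    k<k′ = proj₁ (proj₂ (proj₂ collision))
    same = proj₂ (proj₂ (proj₂ collision))

  -- Otherwise the first N + 1 elements would all lie in [-N, N), which contains
  -- only N pairs {x, -1 - x}.
  element-upper : element N ≤ - + suc N
  element-upper with element N ℤ.≤? - + suc N
  ... | yes p = p
  ... | no ¬p = ⊥-elim (ℕ.<⇒≢ i<j (decreasing-injective element-decreasing
    (fold-injective-P (element∈P (toℕ i)) (element∈P (toℕ j))
      (Fin.fromℕ<-injective _ _ _ _ same))))
    where
    eq : ∀ n e → e - (1ℤ + - (1ℤ + n)) ≡ e - - n
    eq = solve-∀
    fold<N : ∀ (i : Fin (suc N)) → fold (element (toℕ i)) ℕ.< N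
    fold<N i = fold-upper _ (P<N (element∈P (toℕ i))) (ℤ.≤-trans
      (≤-by (≰⇒1+≤ ¬p) (eq (+ N) (element N)))
      (decreasing-≤ element-decreasing (ℕ.s≤s⁻¹ (Fin.toℕ<n i))))
    collision = Fin.pigeonhole (ℕ.n<1+n N) (λ i → fromℕ< (fold<N i))
    i    = proj₁ collision
    j    = proj₁ (proj₂ collision)
    i<j  = proj₁ (proj₂ (proj₂ collision))
    same = proj₂ (proj₂ (proj₂ collision))

  partAt : ℕ → ℕ
  partAt n = ∣ element n + + suc n ∣

  partAt≡ : ∀ n → + partAt n ≡ element n + + suc n
  partAt≡ n = ℤ.0≤i⇒+∣i∣≡i
    (≤-by (element-lower n) (eq (element n) (+ suc n)))
    where
    eq : ∀ e n → e - - n ≡ (e + n) - 0ℤ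
    eq = solve-∀

  partAt-decreasing : ∀ n → partAt (suc n) ℕ.≤ partAt n
  partAt-decreasing n = ℤ.drop‿+≤+ (subst₂ _≤_
    (sym (partAt≡ (suc n))) (sym (partAt≡ n))
    (≤-by (element-decreasing n) (eq (element n) (element (suc n)) (+ n))))
    where
    eq : ∀ a b n → a - (1ℤ + b) ≡ (a + (1ℤ + n)) - (b + (1ℤ + (1ℤ + n)))
    eq = solve-∀

  partAt-antitone : ∀ {m n} → m ℕ.≤ n → partAt n ℕ.≤ partAt m
  partAt-antitone m≤n = go (ℕ.≤⇒≤′ m≤n)
    where
    go : ∀ {m n} → m ℕ.≤′ n → partAt n ℕ.≤ partAt m
    go ℕ.≤′-refl     = ℕ.≤-refl
    go (ℕ.≤′-step p) = ℕ.≤-trans (partAt-decreasing _) (go p)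

  partAt-vanishes : ∀ n → N ℕ.≤ n → partAt n ≡ 0
  partAt-vanishes n N≤n = ℕ.n≤0⇒n≡0 (ℕ.≤-trans (partAt-antitone N≤n)
    (ℤ.drop‿+≤+ (subst (_≤ 0ℤ) (sym (partAt≡ N))
      (≤-by element-upper (eq (element N) (+ suc N))))))
    where
    eq : ∀ e n → - n - e ≡ 0ℤ - (e + n)
    eq = solve-∀

  partition : Partition
  partition = record
    { part       = partAt
    ; decreasing = partAt-decreasing
    -- The diagram fits into a rectangle: at most N nonzero rows, none longer than the first.
    ; bound      = N ℕ.* partAt 0
    ; finiteSum  = sum-bound partAt (partAt 0) N
        (λ i → partAt-antitone ℕ.z≤n) partAt-vanishes
    }

  β≡element : ∀ n → β partition n ≡ element n
  β≡element n = trans (cong (_- + suc n) (partAt≡ n)) (eq (element n) (+ suc n))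
    where
    eq : ∀ e n → (e + n) - n ≡ e
    eq = solve-∀

  BetaSet⇒P : ∀ {x} → BetaSet partition x → P x
  BetaSet⇒P (n , refl) = subst P (sym (β≡element n)) (element∈P n)

  P⇒BetaSet : ∀ {x} → P x → BetaSet partition x
  P⇒BetaSet px = Product.map₂ (λ {n} e → trans e (sym (β≡element n)))
    (element-surjective px)

-- Sums over residues, and the parameterization by a-coordinates

0≤*⇒0≤ : ∀ t .{{_ : NonZero t}} {q} → 0ℤ ≤ q * + t → 0ℤ ≤ q
0≤*⇒0≤ (suc t) {q} = ℤ.*-cancelʳ-≤-pos 0ℤ q (+ suc t)

1≤t : ∀ t .{{_ : NonZero t}} → 1ℤ ≤ + t
1≤t t = ℤ.+≤+ (ℕ.>-nonZero⁻¹ t)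

t≰0 : ∀ t .{{_ : NonZero t}} → ¬ + t ≤ 0ℤ
t≰0 t t≤0 = 1+x≰x (ℤ.≤-trans (1≤t t) t≤0)

∑-cong : ∀ {n} {f g : Fin n → ℤ} → (∀ i → f i ≡ g i) → ∑ f ≡ ∑ g
∑-cong = sum-cong-≗

∑-const : ∀ n c → ∑ {n} (λ _ → c) ≡ + n * c
∑-const zero    c = refl
∑-const (suc n) c = trans (cong (_+_ c) (∑-const n c)) (eq c (+ n))
  where
  eq : ∀ c n → c + n * c ≡ (1ℤ + n) * c
  eq = solve-∀

∑-opposite : ∀ {n} (f : Fin n → ℤ) → ∑ f ≡ ∑ (f ∘ Fin.opposite)
∑-opposite f = sum-permute f Perm.reverse

2*-cancel : ∀ {x y} → + 2 * x ≡ + 2 * y → x ≡ y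
2*-cancel {x} {y} = ℤ.*-cancelˡ-≡ (+ 2) x y

2*C2 : ∀ t .{{_ : NonZero t}} → + 2 * + (t C 2) ≡ + t * (+ t - 1ℤ)
2*C2 (suc zero)    = refl
2*C2 (suc (suc n)) = trans
  (cong (λ m → + 2 * + m) (trans (sym (nCk+nC[k+1]≡[n+1]C[k+1] (suc n) 1))
    (cong (ℕ._+ (suc n C 2)) (nC1≡n (suc n)))))
  (≡-by (2*C2 (suc n)) (eq (+ n) (+ (suc n C 2))))
  where
  eq : ∀ n c → + 2 * c - (1ℤ + n) * ((1ℤ + n) - 1ℤ) ≡
               + 2 * ((1ℤ + n) + c) - (1ℤ + (1ℤ + n)) * ((1ℤ + (1ℤ + n)) - 1ℤ)
  eq = solve-∀

module _ (t : ℕ) .{{_ : NonZero t}} where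

  -- The coordinates a_i and a_{-1-i} are paired, and every pair sums to t - 1.
  symmetric⇒sumBinomial : ∀ {a} → ASymmetric t a → SumBinomial t a
  symmetric⇒sumBinomial {a} sym-a = 2*-cancel (begin
    + 2 * ∑ a                      ≡⟨ eq (∑ a) ⟩
    ∑ a + ∑ a                      ≡⟨ cong (_+_ (∑ a)) (∑-opposite a) ⟩
    ∑ a + ∑ (a ∘ Fin.opposite)     ≡⟨ sym (∑-distrib-+ a (a ∘ Fin.opposite)) ⟩
    ∑ (λ i → a i + a (Fin.opposite i)) ≡⟨ ∑-cong pair ⟩
    ∑ {t} (λ _ → + t - 1ℤ)         ≡⟨ ∑-const t (+ t - 1ℤ) ⟩
    + t * (+ t - 1ℤ)               ≡⟨ sym (2*C2 t) ⟩
    + 2 * + (t C 2)                ∎)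
    where
    open ≡-Reasoning
    eq : ∀ x → + 2 * x ≡ x + x
    eq = solve-∀
    eq₁ : ∀ t i → (t - (1ℤ + i)) ≡ (-1ℤ - i) + 1ℤ * t
    eq₁ = solve-∀
    -- `Fin.opposite` is i ↦ t - 1 - i, a representative of -1 - i.
    opposite≈ : ∀ (i : Fin t) → + toℕ (Fin.opposite i) ≈ -1ℤ - + toℕ i mod t
    opposite≈ i = mod-trans (mod-reflexive (trans
      (cong +_ (Fin.opposite-prop i)) (trans (+-∸ (Fin.toℕ<n i)) (eq₁ (+ t) (+ toℕ i)))))
      (mod-shift (-1ℤ - + toℕ i) 1ℤ)
    pair : ∀ i → a i + a (Fin.opposite i) ≡ + t - 1ℤ
    pair i = trans (cong₂ _+_ (sym ([]-toℕ a i))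
      (trans (sym ([]-toℕ a (Fin.opposite i))) ([]-cong a (opposite≈ i))))
      (sym-a (+ toℕ i))

-- p_i - t is the largest element of P congruent to i.
record Tops (t : ℕ) .{{_ : NonZero t}} (P : Pred ℤ 0ℓ) (p : Point t) : Set where
  field
    residue : ∀ i → p [ i ] ≈ i mod t
    top     : ∀ i → P (p [ i ] - + t)
    maximal : ∀ {x} i → P x → x ≈ i mod t → x + + t ≤ p [ i ]

-- Any choice of maxima will do: only their defining property enters, not the search that produced
-- them.
maxima-tops : ∀ t .{{_ : NonZero t}} l
  (max : ∀ i → ∃ (IsMaximum (BetaClass t l i))) →
  Tops t (BetaSet l) (λ i → + t + proj₁ (max (+ toℕ i)))
maxima-tops t l max = record
  { residue = λ i → residue i (max (index i))
  ; top     = λ i → top (max (index i))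
  ; maximal = λ i → maximal i (max (index i))
  }
  where
  index : ℤ → ℤ
  index i = + toℕ (fromℕ< (n%ℕd<d i t))

  index≈ : ∀ i → index i ≈ i mod t
  index≈ i = subst (λ n → + n ≈ i mod t)
    (sym (Fin.toℕ-fromℕ< (n%ℕd<d i t))) (mod-% i)

  residue : ∀ i (m : ∃ (IsMaximum (BetaClass t l (index i)))) →
            + t + proj₁ m ≈ i mod t
  residue i (m , (_ , m≡) , _) = mod-trans
    (mod-trans (mod-reflexive (eq (+ t) m)) (mod-shift m 1ℤ))
    (mod-trans (mod m≡) (index≈ i))
    where
    eq : ∀ t m → t + m ≡ m + 1ℤ * t
    eq = solve-∀

  top : ∀ {i} (m : ∃ (IsMaximum (BetaClass t l i))) →
        BetaSet l (+ t + proj₁ m - + t)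
  top (m , (m∈ , _) , _) = subst (BetaSet l) (eq (+ t) m) m∈
    where
    eq : ∀ t m → m ≡ (t + m) - t
    eq = solve-∀

  maximal : ∀ i (m : ∃ (IsMaximum (BetaClass t l (index i)))) {x} →
            BetaSet l x → x ≈ i mod t → x + + t ≤ + t + proj₁ m
  maximal i (m , _ , x≤m) {x} x∈ x≈i = subst (x + + t ≤_) (ℤ.+-comm m (+ t))
    (ℤ.+-monoˡ-≤ (+ t) (x≤m x (x∈ , unmod (mod-trans x≈i (mod-sym (index≈ i))))))

aCoords-tops : ∀ t .{{_ : NonZero t}} l → Tops t (BetaSet l) (aCoords t l)
aCoords-tops t l = maxima-tops t l (betaMax t l)

module _ {t : ℕ} .{{_ : NonZero t}} where

  -t≈ : ∀ x → x - + t ≈ x mod t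
  -t≈ x = mod-trans (mod-reflexive (eq x (+ t))) (mod-shift x -1ℤ)
    where
    eq : ∀ x t → x - t ≡ x + -1ℤ * t
    eq = solve-∀

  -t+t : ∀ x → (x - + t) + + t ≡ x
  -t+t x = eq x (+ t)
    where
    eq : ∀ x t → (x - t) + t ≡ x
    eq = solve-∀

  tops-≤ : ∀ {P Q p q} → Tops t P p → Tops t Q q → (∀ {x} → P x → Q x) →
           ∀ i → p [ i ] ≤ q [ i ]
  tops-≤ {p = p} {q} P-tops Q-tops P⊆Q i = subst (_≤ q [ i ]) (-t+t (p [ i ]))
    (maximal Q-tops i (P⊆Q (top P-tops i))
      (mod-trans (-t≈ (p [ i ])) (residue P-tops i)))
    where open Tops

  tops-unique : ∀ {P Q p q} → Tops t P p → Tops t Q q → (∀ {x} → P x → Q x) →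
                (∀ {x} → Q x → P x) → ∀ i → p i ≡ q i
  tops-unique P-tops Q-tops P⊆Q Q⊆P = ext-[] λ i → ℤ.≤-antisym
    (tops-≤ P-tops Q-tops P⊆Q i) (tops-≤ Q-tops P-tops Q⊆P i)

  closed-* : ∀ {P} → ClosedUnder t P → ∀ n {x} → P x → P (x - + n * + t)
  closed-* {P} closed zero    {x} px = subst P (eq x (+ t)) px
    where
    eq : ∀ x t → x ≡ x - 0ℤ * t
    eq = solve-∀
  closed-* {P} closed (suc n) {x} px =
    subst P (eq x (+ n) (+ t)) (closed (closed-* {P} closed n px))
    where
    eq : ∀ x n t → (x - n * t) - t ≡ x - (1ℤ + n) * t
    eq = solve-∀

  module _ {P p} (tops : Tops t P p) (closed : ClosedUnder t P) where

    open Tops tops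

    -- Write a_x = x + q t. Then x lies q - 1 ≥ 0 steps of length t below the top element a_x - t,
    -- and closedness descends to it.
    below-top : ∀ {x} → x + + t ≤ p [ x ] → P x
    below-top {x} x+t≤a with residue x
    ... | mod (divides q e) = subst P (≡-by₂ e (cong (_* + t) q-1≡) (eq (p [ x ]) x q (+ t) (+ ∣ q - 1ℤ ∣)))
      (closed-* {P} closed ∣ q - 1ℤ ∣ (top x))
      where
      eq : ∀ a x q t n → ((a - x) - q * t) + ((q - 1ℤ) * t - n * t) ≡ ((a - t) - n * t) - x
      eq = solve-∀
      eq₁ : ∀ a x q t → a - (x + t) ≡ (a - x) - t
      eq₁ = solve-∀
      eq₂ : ∀ q t → q * t - t ≡ (q - 1ℤ) * t
      eq₂ = solve-∀
      q-1≡ : q - 1ℤ ≡ + ∣ q - 1ℤ ∣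
      q-1≡ = sym (ℤ.0≤i⇒+∣i∣≡i (0≤*⇒0≤ t (subst (0ℤ ≤_)
        (trans (eq₁ (p [ x ]) x q (+ t)) (trans (cong (_- + t) e) (eq₂ q (+ t))))
        (ℤ.i≤j⇒0≤j-i x+t≤a))))

    ∈⇒below-top : ∀ {x} → P x → x + + t ≤ p [ x ]
    ∈⇒below-top {x} x∈ = maximal x x∈ (mod-reflexive refl)

    -- The top element of class i + s, moved down by s, lands in class i and is bounded by the top
    -- element there.
    closed⇒inequalities : ∀ {s} → ClosedUnder s P →
                          CoreInequalities t s p
    closed⇒inequalities {s} closed-s i = ≤-by
      (maximal i (closed-s (top (i + + s))) (mod-trans
        (mod-trans (mod-reflexive (eq (p [ i + + s ]) (+ s) (+ t))) (mod-shift _ -1ℤ))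
        (mod-trans (mod-+ (residue (i + + s)) (mod-reflexive refl))
          (mod-reflexive (eq₁ i (+ s))))))
      (eq₂ (p [ i ]) (p [ i + + s ]) (+ s) (+ t))
      where
      eq : ∀ a s t → (a - t) - s ≡ (a - s) + -1ℤ * t
      eq = solve-∀
      eq₁ : ∀ i s → (i + s) - s ≡ i
      eq₁ = solve-∀
      eq₂ : ∀ a b s t → a - (((b - t) - s) + t) ≡ a - (b - s)
      eq₂ = solve-∀

    inequalities⇒closed : ∀ {s} → CoreInequalities t s p →
                          ClosedUnder s P
    inequalities⇒closed {s} ineq {x} x∈ = below-top (≤-by₂
      (∈⇒below-top x∈)
      (subst (λ y → p [ y ] - + s ≤ p [ x - + s ]) (eq x (+ s)) (ineq (x - + s)))
      (eq₁ x (+ s) (+ t) (p [ x ]) (p [ x - + s ])))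
      where
      eq : ∀ x s → (x - s) + s ≡ x
      eq = solve-∀
      eq₁ : ∀ x s t a b → (a - (x + t)) + (b - (a - s)) ≡ b - ((x - s) + t)
      eq₁ = solve-∀

    -- Since a_i is missing from P, -1 - a_i is in P, and the top of its class -1 - i bounds it:
    -- this is the lower estimate. For the upper one, the dual of the top of class -1 - i is missing
    -- from P and lies in class i, so it is at least a_i.
    selfDual⇒symmetric : SelfDual P → ASymmetric t p
    selfDual⇒symmetric dual i = ℤ.≤-antisym upper lower
      where
      a∉ : ¬ P (p [ i ])
      a∉ a∈ = t≰0 t
        (≤-by (maximal i a∈ (residue i)) (eq (p [ i ]) (+ t)))
        where
        eq : ∀ a t → a - (a + t) ≡ 0ℤ - t
        eq = solve-∀
      lower : + t - 1ℤ ≤ p [ i ] + p [ -1ℤ - i ]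
      lower = ≤-by (maximal (-1ℤ - i) (selfDual-∉ dual a∉)
        (mod-+ (mod-reflexive {x = -1ℤ} refl) (mod-neg (residue i))))
        (eq (p [ i ]) (p [ -1ℤ - i ]) (+ t))
        where
        eq : ∀ a b t → b - ((-1ℤ - a) + t) ≡ (a + b) - (t - 1ℤ)
        eq = solve-∀
      b = p [ -1ℤ - i ]
      x = -1ℤ - (b - + t)
      x≈i : x ≈ i mod t
      x≈i = mod-trans (mod-trans (mod-reflexive (eq b (+ t))) (mod-shift _ 1ℤ))
        (mod-trans (mod-+ (mod-reflexive {x = -1ℤ} refl) (mod-neg (residue (-1ℤ - i))))
          (mod-reflexive (eq₁ i)))
        where
        eq : ∀ b t → -1ℤ - (b - t) ≡ (-1ℤ - b) + 1ℤ * t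
        eq = solve-∀
        eq₁ : ∀ i → -1ℤ - (-1ℤ - i) ≡ i
        eq₁ = solve-∀
      upper : p [ i ] + b ≤ + t - 1ℤ
      upper = [ (λ a≤x → ≤-by a≤x (eq (p [ i ]) b (+ t)))
              , (λ x+t≤a → contradiction
                  (below-top (subst (x + + t ≤_) ([]-cong p (mod-sym x≈i)) x+t≤a))
                  (selfDual-∈ dual (top (-1ℤ - i))))
              ]′ (mod-gap (mod-trans (residue i) (mod-sym x≈i)))
        where
        eq : ∀ a b t → (-1ℤ - (b - t)) - a ≡ (t - 1ℤ) - (a + b)
        eq = solve-∀

  tops-⊆ : ∀ {P Q p q} → Tops t P p → Tops t Q q → ClosedUnder t Q →
           (∀ i → p i ≡ q i) → ∀ {x} → P x → Q x
  tops-⊆ P-tops Q-tops Q-closed p≗q {x} px = below-top Q-tops Q-closed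
    (subst (x + + t ≤_) (p≗q _) (Tops.maximal P-tops x px (mod-reflexive refl)))

betaSet-cong : ∀ {l m} → (∀ i → part l i ≡ part m i) →
               ∀ {x} → BetaSet l x → BetaSet m x
betaSet-cong e (i , refl) = i , cong (λ p → + p - + suc i) (e i)

point-bound : ∀ {n} (p : Point n) → ∃ λ N → ∀ i → p i ≤ + N
point-bound {zero}  p = 0 , λ ()
point-bound {suc n} p with point-bound (p ∘ suc)
... | N , p≤N = ∣ p zero ∣ ℕ.+ N , λ where
  zero    → ℤ.≤-trans (i≤+∣i∣ (p zero)) (ℤ.+≤+ (ℕ.m≤m+n ∣ p zero ∣ N))
  (suc i) → ℤ.≤-trans (p≤N i) (ℤ.+≤+ (ℕ.m≤n+m N ∣ p zero ∣))

module FromCoords (t : ℕ) .{{_ : NonZero t}} (a : Point t)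
                  (residue : Residues t a) (symmetric : ASymmetric t a) where

  Below : Pred ℤ 0ℓ
  Below x = x + + t ≤ a [ x ]

  -- If x and -1 - x both lay in the set, the two inequalities would add up to 2t - 1 ≤ t - 1. If x
  -- does not, then a_x ≤ x by congruence, and the symmetry puts -1 - x into the set.
  below-dual : SelfDual Below
  below-dual x with x + + t ℤ.≤? a [ x ]
  ... | yes x+t≤a = inj₁ (x+t≤a , λ x′+t≤a′ → t≰0 t
    (≤-by (ℤ.+-mono-≤ x+t≤a x′+t≤a′)
      (trans (cong (_- ((x + + t) + ((-1ℤ - x) + + t))) (symmetric x)) (eq x (+ t)))))
    where
    eq : ∀ x t → (t - 1ℤ) - ((x + t) + ((-1ℤ - x) + t)) ≡ 0ℤ - t
    eq = solve-∀
  ... | no ¬p with mod-gap (mod (residue x))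
  ...   | inj₂ x+t≤a = contradiction x+t≤a ¬p
  ...   | inj₁ a≤x = inj₂ (¬p , ≤-by₂ a≤x (ℤ.≤-reflexive (sym (symmetric x)))
      (eq x (+ t) (a [ x ]) (a [ -1ℤ - x ])))
    where
    eq : ∀ x t a b → (x - a) + ((a + b) - (t - 1ℤ)) ≡ b - ((-1ℤ - x) + t)
    eq = solve-∀

  below-bounded : ∀ {x} → Below x → 1ℤ + x ≤ + proj₁ (point-bound a)
  below-bounded {x} below = ≤-by₂ (ℤ.≤-trans below (proj₂ (point-bound a) _)) (1≤t t)
    (eq x (+ t) (+ proj₁ (point-bound a)))
    where
    eq : ∀ x t n → (n - (x + t)) + (t - 1ℤ) ≡ n - (1ℤ + x)
    eq = solve-∀

  below-closed : ClosedUnder t Below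
  below-closed {x} below = subst₂ _≤_ (eq x (+ t)) ([]-cong a (mod-sym (-t≈ x)))
    (ℤ.≤-trans (ℤ.i≤i+j x (+ t)) below)
    where
    eq : ∀ x t → x ≡ (x - t) + t
    eq = solve-∀

  open FromBetaSet below-dual (proj₁ (point-bound a))
    (λ {x} → below-bounded {x}) public
    using (partition; BetaSet⇒P; P⇒BetaSet)

  partition-core : Core t partition
  partition-core = closed⇒core {l = partition}
    (λ {x} x∈ → P⇒BetaSet (below-closed {x} (BetaSet⇒P x∈)))

  partition-selfConjugate : SelfConjugate partition
  partition-selfConjugate = selfDual⇒selfConjugate {partition} λ x → Sum.map
    (Product.map P⇒BetaSet (_∘ BetaSet⇒P))
    (Product.map (_∘ BetaSet⇒P) P⇒BetaSet)
    (below-dual x)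

  below-tops : Tops t Below a
  below-tops = record
    { residue = mod ∘ residue
    ; top     = λ i → ℤ.≤-reflexive (trans (-t+t (a [ i ]))
        ([]-cong a (mod-sym (mod-trans (-t≈ (a [ i ])) (mod (residue i))))))
    ; maximal = λ {x} i below x≈i → subst (x + + t ≤_) ([]-cong a x≈i) below
    }

module _ (t : ℕ) .{{_ : NonZero t}} where

  aCoords-cong : ∀ {l m} → (∀ i → part l i ≡ part m i) →
                ∀ i → aCoords t l i ≡ aCoords t m i
  aCoords-cong {l} {m} e = tops-unique (aCoords-tops t l) (aCoords-tops t m)
    (betaSet-cong {l} {m} e) (betaSet-cong {m} {l} (sym ∘ e))

  aCoords-injective : ∀ {l m} → ClosedUnder t (BetaSet l) →
    ClosedUnder t (BetaSet m) → (∀ i → aCoords t l i ≡ aCoords t m i) →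
    ∀ i → part l i ≡ part m i
  aCoords-injective {l} {m} l-closed m-closed e = betaSet-injective {l} {m}
    (tops-⊆ (aCoords-tops t l) (aCoords-tops t m) m-closed e)
    (tops-⊆ (aCoords-tops t m) (aCoords-tops t l) l-closed (sym ∘ e))

  aCoords-partition : ∀ a (residue : Residues t a) (symmetric : ASymmetric t a) →
    ∀ i → aCoords t (FromCoords.partition t a residue symmetric) i ≡ a i
  aCoords-partition a residue symmetric =
    tops-unique (aCoords-tops t partition) below-tops BetaSet⇒P P⇒BetaSet
    where open FromCoords t a residue symmetric

-- The change from a- to z-coordinates

parity : ∀ n → 2 ℕ.∣ n ⊎ 2 ℕ.∣ suc n
parity zero    = inj₁ (2 ℕ.∣0)
parity (suc n) = [ (λ (ℕ.divides q e) → inj₂ (ℕ.divides (suc q) (cong (λ m → suc (suc m)) e)))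
                 , inj₁ ]′ (parity n)

2∣⇒2*⌊/2⌋ : ∀ {n} → 2 ℕ.∣ n → + 2 * + ⌊ n /2⌋ ≡ + n
2∣⇒2*⌊/2⌋ (ℕ.divides q refl) = trans
  (cong (λ m → + 2 * + m) (trans (cong ⌊_/2⌋ (trans (ℕ.*-comm q 2)
    (cong (q ℕ.+_) (ℕ.+-identityʳ q)))) (sym (ℕ.n≡⌊n+n/2⌋ q))))
  (trans (sym (ℤ.pos-* 2 q)) (cong +_ (ℕ.*-comm 2 q)))

module _ {s t : ℕ} .{{_ : NonZero t}} (coprime : Coprime s t) where

  coprime-odd : 2 ℕ.∣ t → 2 ℕ.∣ suc s
  coprime-odd 2∣t = [ (λ 2∣s → contradiction (coprime (2∣s , 2∣t)) λ ()) , id ]′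
    (parity s)

  -- If t - 1 is odd, then t is even and coprimality makes s odd.
  shift-even : 2 ℕ.∣ suc s ℕ.* (t ℕ.∸ 1)
  shift-even = [ ℕ.∣n⇒∣m*n (suc s)
               , (λ 2∣t → ℕ.∣m⇒∣m*n (t ℕ.∸ 1)
                   (coprime-odd (subst (2 ℕ.∣_) (ℕ.suc-pred t) 2∣t)))
               ]′ (parity (t ℕ.∸ 1))

  2*shift : + 2 * + shift s t ≡ (1ℤ + + s) * (+ t - 1ℤ)
  2*shift = trans (2∣⇒2*⌊/2⌋ shift-even) (trans (ℤ.pos-* (suc s) (t ℕ.∸ 1))
    (cong ((1ℤ + + s) *_) (+-∸ (ℕ.>-nonZero⁻¹ t))))

  inverse : ∃ λ e → e * + s ≈ 1ℤ mod t
  inverse with coprime-Bézout coprime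
  ... | Bézout.+- x y eq = + x , mod-trans (mod-reflexive (trans (sym (ℤ.pos-* x s))
    (trans (cong +_ (sym eq)) (cong (_+_ 1ℤ) (ℤ.pos-* y t))))) (mod-shift 1ℤ (+ y))
  ... | Bézout.-+ x y eq = - + x , mod-trans (mod-reflexive (sym
    (≡-by (trans (cong (_+_ 1ℤ) (sym (ℤ.pos-* x s)))
      (trans (cong +_ eq) (ℤ.pos-* y t))) (eq₁ (+ x) (+ s) (+ y) (+ t)))))
    (mod-shift 1ℤ (- + y))
    where
    eq₁ : ∀ x s y t → (1ℤ + x * s) - y * t ≡ (1ℤ + - y * t) - (- x * s)
    eq₁ = solve-∀

module _ {t : ℕ} .{{_ : NonZero t}} where

  *t-cancel : ∀ {x y} → x * + t ≡ y * + t → x ≡ y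
  *t-cancel {x} {y} = ℤ.*-cancelʳ-≡ x y (+ t)

  /ℕ-exact : ∀ {n} → + t ∣ n → (n /ℕ t) * + t ≡ n
  /ℕ-exact {n} (divides q e) = sym (trans (a≡a%ℕn+[a/ℕn]*n n t)
    (trans (cong (λ r → + r + (n /ℕ t) * + t) remainder≡0) (ℤ.+-identityˡ _)))
    where
    remainder≡0 : n %ℕ t ≡ 0
    remainder≡0 = mod-unique (n%ℕd<d n t) (ℕ.>-nonZero⁻¹ t)
      (mod-trans (mod-% n) (mod (divides q (trans (ℤ.+-identityʳ n) e))))

  /ℕ-unique : ∀ {n q} → n ≡ q * + t → n /ℕ t ≡ q
  /ℕ-unique {n} {q} e = *t-cancel (trans (/ℕ-exact (divides q e)) e)

∑-* : ∀ {n} (f : Fin n → ℤ) c → ∑ f * c ≡ ∑ (λ i → f i * c)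
∑-* {zero}  f c = refl
∑-* {suc n} f c = trans (ℤ.*-distribʳ-+ c (f zero) (∑ (f ∘ suc)))
  (cong (_+_ (f zero * c)) (∑-* (f ∘ suc) c))

∑-telescope : ∀ n (g : ℕ → ℤ) →
              ∑ {n} (λ i → g (toℕ i) - g (suc (toℕ i))) ≡ g 0 - g n
∑-telescope zero    g = sym (ℤ.+-inverseʳ (g 0))
∑-telescope (suc n) g = trans (cong (_+_ (g 0 - g 1)) (∑-telescope n (g ∘ suc)))
  (eq (g 0) (g 1) (g (suc n)))
  where
  eq : ∀ a b c → (a - b) + (b - c) ≡ a - c
  eq = solve-∀

induction-ℤ/t : ∀ t .{{_ : NonZero t}} {P : Pred ℤ 0ℓ} →
  (∀ {i j} → i ≈ j mod t → P i → P j) → P 0ℤ → (∀ i → P i → P (i + 1ℤ)) → ∀ i → P i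
induction-ℤ/t t {P} resp p0 step i = resp (mod-% i) (go (i %ℕ t))
  where
  go : ∀ n → P (+ n)
  go zero    = p0
  go (suc n) = subst P (ℤ.+-comm (+ n) 1ℤ) (step (+ n) (go n))

-- With g_j = a_{sj+k}, the z-coordinates satisfy t z_j = g_j - g_{j+1} + s.

module _ (s t : ℕ) .{{_ : NonZero t}} where

  private
    k = + shift s t

  walk : Point t → ℤ → ℤ
  walk a j = a [ + s * j + k ]

  affine-cong : ∀ {i j} → i ≈ j mod t → + s * i + k ≈ + s * j + k mod t
  affine-cong i≈j = mod-+ (mod-* (+ s) i≈j) (mod-reflexive refl)

  walk-cong : ∀ a {i j} → i ≈ j mod t → walk a i ≡ walk a j
  walk-cong a i≈j = []-cong a (affine-cong i≈j)

  zNumerator-cong : ∀ a {i j} → i ≈ j mod t → zNumerator s a i ≡ zNumerator s a j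
  zNumerator-cong a {i} {j} i≈j = cong₂ (λ x y → x - (y - + s)) (walk-cong a i≈j)
    (walk-cong a {i + 1ℤ} {j + 1ℤ} (mod-+ i≈j (mod-reflexive refl)))

  aToZ-[] : ∀ a j → aToZ s a [ j ] ≡ zNumerator s a j /ℕ t
  aToZ-[] a = []-tabulate {f = λ j → zNumerator s a j /ℕ t}
    (λ i≈j → cong (_/ℕ t) (zNumerator-cong a i≈j))

  aToZ-cong : ∀ {a b : Point t} → (∀ i → a i ≡ b i) → ∀ i → aToZ s a i ≡ aToZ s b i
  aToZ-cong a≗b i = cong₂ (λ x y → (x - (y - + s)) /ℕ t) (a≗b _) (a≗b _)

  residue≈ : ∀ (a : Point t) → Residues t a → ∀ i → a [ i ] ≈ i mod t
  residue≈ a residue i = mod (residue i)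

  residues⇒exact : ∀ a → Residues t a → ∀ j → + t ∣ zNumerator s a j
  residues⇒exact a residue j = subst (+ t ∣_)
    (ℤ.+-identityʳ (zNumerator s a j))
    (unmod (mod-trans (mod-+ (residue≈ a residue (+ s * j + k))
      (mod-neg (mod-+ (residue≈ a residue (+ s * (j + 1ℤ) + k)) (mod-reflexive {x = - + s} refl))))
      (mod-reflexive (eq (+ s) j k))))
    where
    eq : ∀ s j k → (s * j + k) - (s * (j + 1ℤ) + k - s) ≡ 0ℤ
    eq = solve-∀

  aToZ-exact : ∀ a → Residues t a →
               ∀ j → (aToZ s a [ j ]) * + t ≡ zNumerator s a j
  aToZ-exact a residue j = trans (cong (_* + t) (aToZ-[] a j))
    (/ℕ-exact (residues⇒exact a residue j))

  aToZ-exact-Fin : ∀ a → Residues t a →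
                   ∀ i → aToZ s a i * + t ≡ zNumerator s a (+ toℕ i)
  aToZ-exact-Fin a residue i = trans (cong (_* + t) (sym ([]-toℕ (aToZ s a) i)))
    (aToZ-exact a residue (+ toℕ i))

  walk-suc : ∀ a n → walk a (+ n + 1ℤ) ≡ walk a (+ suc n)
  walk-suc a n = cong (walk a) (ℤ.+-comm (+ n) 1ℤ)

  walk-period : ∀ a → walk a (+ t) ≡ walk a 0ℤ
  walk-period a = walk-cong a (mod-trans
    (mod-reflexive (sym (trans (ℤ.+-identityˡ (1ℤ * + t)) (ℤ.*-identityˡ (+ t)))))
    (mod-shift 0ℤ 1ℤ))

  aToZ-sum : ∀ a → Residues t a → SumsTo s (aToZ s a)
  aToZ-sum a residue = *t-cancel (begin
    ∑ (aToZ s a) * + t                              ≡⟨ ∑-* (aToZ s a) (+ t) ⟩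
    ∑ (λ i → aToZ s a i * + t)                      ≡⟨ ∑-cong {t} term ⟩
    ∑ {t} (λ i → g (toℕ i) - g (suc (toℕ i)))       ≡⟨ ∑-telescope t g ⟩
    g 0 - (walk a (+ t) - + s * + t)                ≡⟨ cong (λ x → g 0 - (x - + s * + t)) (walk-period a) ⟩
    g 0 - (walk a 0ℤ - + s * + t)                   ≡⟨ eq₂ (walk a 0ℤ) (+ s) (+ t) ⟩
    + s * + t                                       ∎)
    where
    open ≡-Reasoning
    -- The walk tilted by -s n, so that t z_n is the plain difference g n - g (n + 1). The walk
    -- closes up after t steps, and the sum telescopes to the tilt s t.
    g : ℕ → ℤ
    g n = walk a (+ n) - + s * + n
    eq₁ : ∀ x y s n → x - (y - s) ≡ (x - s * n) - (y - s * (1ℤ + n))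
    eq₁ = solve-∀
    eq₂ : ∀ x s t → (x - s * 0ℤ) - (x - s * t) ≡ s * t
    eq₂ = solve-∀
    term : ∀ (i : Fin t) → aToZ s a i * + t ≡ g (toℕ i) - g (suc (toℕ i))
    term i = trans (aToZ-exact-Fin a residue i)
      (trans (cong (λ y → walk a (+ toℕ i) - (y - + s)) (walk-suc a (toℕ i)))
        (eq₁ (walk a (+ toℕ i)) (walk a (+ suc (toℕ i))) (+ s) (+ toℕ i)))

  module _ (coprime : Coprime s t) where

    private
      2k≡ : + 2 * k ≡ (1ℤ + + s) * (+ t - 1ℤ)
      2k≡ = 2*shift coprime

      e : ℤ
      e = proj₁ (inverse {s} {t} coprime)

      es≈1 : e * + s ≈ 1ℤ mod t
      es≈1 = proj₂ (inverse {s} {t} coprime)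

    -- Since 2k + 1 ≡ -s, the reflection i ↦ -1 - i becomes j ↦ 1 - j.
    reflect≈ : ∀ j → -1ℤ - (+ s * j + k) ≈ + s * (1ℤ - j) + k mod t
    reflect≈ j = mod-trans (mod-reflexive
      (≡-by (sym 2k≡) (eq (+ s) j k (+ t)))) (mod-shift _ (- (1ℤ + + s)))
      where
      eq : ∀ s j k t → (1ℤ + s) * (t - 1ℤ) - + 2 * k ≡
        (-1ℤ - (s * j + k)) - (s * (1ℤ - j) + k + - (1ℤ + s) * t)
      eq = solve-∀

    walk-reflect : ∀ a → ASymmetric t a →
                   ∀ j → walk a j + walk a (1ℤ - j) ≡ + t - 1ℤ
    walk-reflect a sym-a j = trans
      (cong (_+_ (walk a j)) (sym ([]-cong a (reflect≈ j)))) (sym-a (+ s * j + k))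

    -- The reflection carries the step from j to j + 1 to the step from -j to 1 - j, with the same
    -- height difference: subtract `walk-reflect` at j + 1 from that at j.
    aToZ-symmetric : ∀ a → Residues t a → ASymmetric t a →
                     ZSymmetric t (aToZ s a)
    aToZ-symmetric a residue sym-a j = *t-cancel (trans (aToZ-exact a residue j)
      (trans (≡-by₂ (walk-reflect a sym-a j)
          (sym (trans (cong (λ i → walk a (j + 1ℤ) + walk a i) (sym (eq₂ j)))
            (walk-reflect a sym-a (j + 1ℤ))))
          (eq₁ (walk a j) (walk a (j + 1ℤ)) (walk a (1ℤ - j)) (walk a (- j)) (+ s) (+ t)))
        (sym (trans (aToZ-exact a residue (- j))
          (cong (λ i → walk a (- j) - (walk a i - + s)) (ℤ.+-comm (- j) 1ℤ))))))
      where
      eq₁ : ∀ g g₁ h h₁ s t → (g + h - (t - 1ℤ)) + ((t - 1ℤ) - (g₁ + h₁)) ≡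
                              (g - (g₁ - s)) - (h₁ - (h - s))
      eq₁ = solve-∀
      eq₂ : ∀ j → 1ℤ - (j + 1ℤ) ≡ - j
      eq₂ = solve-∀

    -- The terms g_{j+1} and g_{-j} sum to t - 1.
    walk-sum : ∀ a → ASymmetric t a →
               + 2 * ∑ {t} (λ i → walk a (+ suc (toℕ i))) ≡ + t * (+ t - 1ℤ)
    walk-sum a sym-a = begin
      + 2 * ∑ g                          ≡⟨ eq (∑ g) ⟩
      ∑ g + ∑ g                          ≡⟨ cong (_+_ (∑ g)) (∑-opposite g) ⟩
      ∑ g + ∑ (g ∘ Fin.opposite)         ≡⟨ sym (∑-distrib-+ g (g ∘ Fin.opposite)) ⟩
      ∑ (λ i → g i + g (Fin.opposite i)) ≡⟨ ∑-cong pair ⟩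
      ∑ {t} (λ _ → + t - 1ℤ)             ≡⟨ ∑-const t (+ t - 1ℤ) ⟩
      + t * (+ t - 1ℤ)                   ∎
      where
      open ≡-Reasoning
      g : Fin t → ℤ
      g i = walk a (+ suc (toℕ i))
      eq : ∀ x → + 2 * x ≡ x + x
      eq = solve-∀
      eq₁ : ∀ t i → 1ℤ + (t - (1ℤ + i)) ≡ (1ℤ - (1ℤ + i)) + 1ℤ * t
      eq₁ = solve-∀
      opposite≈ : ∀ (i : Fin t) →
                  + suc (toℕ (Fin.opposite i)) ≈ 1ℤ - + suc (toℕ i) mod t
      opposite≈ i = mod-trans (mod-reflexive (trans
        (cong (λ n → 1ℤ + n) (trans (cong +_ (Fin.opposite-prop i)) (+-∸ (Fin.toℕ<n i))))
        (eq₁ (+ t) (+ toℕ i)))) (mod-shift (1ℤ - + suc (toℕ i)) 1ℤ)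
      pair : ∀ i → g i + g (Fin.opposite i) ≡ + t - 1ℤ
      pair i = trans (cong (_+_ (g i)) (walk-cong a (opposite≈ i)))
        (walk-reflect a sym-a (+ suc (toℕ i)))

    -- Summation by parts: t ∑ j z_j = ∑ g_{j+1} - t g_t + s ∑ j.
    aToZ-weighted : ∀ a → Residues t a → ASymmetric t a →
                    ∑ (λ i → + toℕ i * aToZ s a i) ≡ k - walk a 0ℤ
    aToZ-weighted a residue sym-a = 2*-cancel (*t-cancel (begin
      + 2 * ∑ w * + t
        ≡⟨ eq₁ (∑ w) (+ t) ⟩
      ∑ w * (+ 2 * + t)
        ≡⟨ ∑-* w (+ 2 * + t) ⟩
      ∑ (λ i → w i * (+ 2 * + t))
        ≡⟨ ∑-cong {t} term ⟩
      ∑ {t} (λ i → (h (toℕ i) - h (suc (toℕ i))) + g i * + 2)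
        ≡⟨ ∑-distrib-+ {t} (λ i → h (toℕ i) - h (suc (toℕ i))) (λ i → g i * + 2) ⟩
      ∑ {t} (λ i → h (toℕ i) - h (suc (toℕ i))) + ∑ (λ i → g i * + 2)
        ≡⟨ cong₂ _+_ (∑-telescope t h) (sym (∑-* g (+ 2))) ⟩
      (h 0 - h t) + ∑ g * + 2
        ≡⟨ cong₂ (λ x y → (h 0 - (+ 2 * + t * x - + s * (+ t * (+ t - 1ℤ)))) + y)
             (walk-period a) (trans (ℤ.*-comm (∑ g) (+ 2)) (walk-sum a sym-a)) ⟩
      (h 0 - (+ 2 * + t * walk a 0ℤ - + s * (+ t * (+ t - 1ℤ)))) + + t * (+ t - 1ℤ)
        ≡⟨ eq₂ (+ s) (+ t) (walk a 0ℤ) ⟩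
      ((1ℤ + + s) * (+ t - 1ℤ) - + 2 * walk a 0ℤ) * + t
        ≡⟨ cong (λ x → (x - + 2 * walk a 0ℤ) * + t) (sym 2k≡) ⟩
      (+ 2 * k - + 2 * walk a 0ℤ) * + t
        ≡⟨ cong (_* + t) (eq₃ k (walk a 0ℤ)) ⟩
      + 2 * (k - walk a 0ℤ) * + t ∎))
      where
      open ≡-Reasoning
      w g : Fin t → ℤ
      w i = + toℕ i * aToZ s a i
      g i = walk a (+ suc (toℕ i))
      -- The telescoping part of 2 n t z_n = h n - h (n + 1) + 2 g_{n+1}. The factor 2 avoids
      -- halving n(n - 1).
      h : ℕ → ℤ
      h n = + 2 * + n * walk a (+ n) - + s * (+ n * (+ n - 1ℤ))
      eq₁ : ∀ x t → + 2 * x * t ≡ x * (+ 2 * t)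
      eq₁ = solve-∀
      eq₂ : ∀ s t g → ((+ 2 * 0ℤ * g - s * (0ℤ * (0ℤ - 1ℤ))) -
                       (+ 2 * t * g - s * (t * (t - 1ℤ)))) + t * (t - 1ℤ) ≡
                      ((1ℤ + s) * (t - 1ℤ) - + 2 * g) * t
      eq₂ = solve-∀
      eq₃ : ∀ k g → + 2 * k - + 2 * g ≡ + 2 * (k - g)
      eq₃ = solve-∀
      eq₄ : ∀ n z t → n * z * (+ 2 * t) ≡ + 2 * n * (z * t)
      eq₄ = solve-∀
      eq₅ : ∀ n s g g₁ → + 2 * n * (g - (g₁ - s)) ≡
        ((+ 2 * n * g - s * (n * (n - 1ℤ))) -
         (+ 2 * (1ℤ + n) * g₁ - s * ((1ℤ + n) * ((1ℤ + n) - 1ℤ)))) + g₁ * + 2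
      eq₅ = solve-∀
      term : ∀ (i : Fin t) → w i * (+ 2 * + t) ≡
                             (h (toℕ i) - h (suc (toℕ i))) + g i * + 2
      term i = trans (eq₄ (+ toℕ i) (aToZ s a i) (+ t))
        (trans (cong (+ 2 * + toℕ i *_) (trans (aToZ-exact-Fin a residue i)
          (cong (λ y → walk a (+ toℕ i) - (y - + s)) (walk-suc a (toℕ i)))))
          (eq₅ (+ toℕ i) (+ s) (walk a (+ toℕ i)) (g i)))

    aToZ-maps : ∀ {a : Point t} → BAll t a → UAll t s (aToZ s a)
    aToZ-maps {a} (_ , residue , sym-a) =
      aToZ-sum a residue ,
      unmod (mod-trans (mod-reflexive (aToZ-weighted a residue sym-a))
        (mod-trans (mod-+ (mod-reflexive {x = k} refl) (mod-neg (residue≈ a residue (+ s * 0ℤ + k))))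
          (mod-reflexive (eq (+ s) k)))) ,
      aToZ-symmetric a residue sym-a
      where
      eq : ∀ s k → k - (s * 0ℤ + k) ≡ 0ℤ
      eq = solve-∀

    -- As e inverts s modulo t, the walk visits class i at the index e(i - k); so it passes through
    -- every coordinate.
    index≈ : ∀ i → + s * (e * (i - k)) + k ≈ i mod t
    index≈ i = mod-trans (mod-reflexive (eq₁ (+ s) e i k))
      (mod-trans (mod-+ (mod-* (i - k) es≈1) (mod-reflexive {x = k} refl))
        (mod-reflexive (eq₂ i k)))
      where
      eq₁ : ∀ s e i k → s * (e * (i - k)) + k ≡ (i - k) * (e * s) + k
      eq₁ = solve-∀
      eq₂ : ∀ i k → (i - k) * 1ℤ + k ≡ i
      eq₂ = solve-∀

    index⁻¹≈ : ∀ j → e * ((+ s * j + k) - k) ≈ j mod t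
    index⁻¹≈ j = mod-trans (mod-reflexive (eq₁ (+ s) e j k))
      (mod-trans (mod-* j es≈1) (mod-reflexive (ℤ.*-identityʳ j)))
      where
      eq₁ : ∀ s e j k → e * ((s * j + k) - k) ≡ j * (e * s)
      eq₁ = solve-∀

    []≡walk : ∀ (a : Point t) i → a [ i ] ≡ walk a (e * (i - k))
    []≡walk a i = sym ([]-cong a (index≈ i))

    aToZ-injective : ∀ {a b : Point t} → BAll t a → BAll t b →
                     (∀ i → aToZ s a i ≡ aToZ s b i) → ∀ i → a i ≡ b i
    aToZ-injective {a} {b} (_ , a-res , a-sym) (_ , b-res , b-sym) z≡ =
      ext-[] λ i → trans ([]≡walk a i) (trans (walks (e * (i - k))) (sym ([]≡walk b i)))
      where
      step : ∀ j → walk a j - walk b j ≡ walk a (j + 1ℤ) - walk b (j + 1ℤ)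
      step j = ≡-by (trans (sym (aToZ-exact a a-res j))
        (trans (cong (_* + t) ([]-ext {p = aToZ s a} {aToZ s b} z≡ j)) (aToZ-exact b b-res j)))
        (eq (walk a j) (walk a (j + 1ℤ)) (walk b j) (walk b (j + 1ℤ)) (+ s))
        where
        eq : ∀ a a₁ b b₁ s → (a - (a₁ - s)) - (b - (b₁ - s)) ≡ (a - b) - (a₁ - b₁)
        eq = solve-∀
      -- The difference of the two walks agrees at 0 and 1 by `step`, and its values there are
      -- opposite by reflection; so it vanishes.
      start : walk a 0ℤ ≡ walk b 0ℤ
      start = 2*-cancel (≡-by₂ (trans (walk-reflect a a-sym 0ℤ) (sym (walk-reflect b b-sym 0ℤ)))
        (step 0ℤ) (eq (walk a 0ℤ) (walk a 1ℤ) (walk b 0ℤ) (walk b 1ℤ)))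
        where
        eq : ∀ a a₁ b b₁ → ((a + a₁) - (b + b₁)) + ((a - b) - (a₁ - b₁)) ≡
                           + 2 * a - + 2 * b
        eq = solve-∀
      walks : ∀ j → walk a j ≡ walk b j
      walks = induction-ℤ/t t
        (λ i≈j p → trans (sym (walk-cong a i≈j)) (trans p (walk-cong b i≈j)))
        start (λ j p → ≡-by₂ p (sym (step j))
          (eq (walk a j) (walk a (j + 1ℤ)) (walk b j) (walk b (j + 1ℤ))))
        where
        eq : ∀ a a₁ b b₁ → (a - b) + ((a₁ - b₁) - (a - b)) ≡ a₁ - b₁
        eq = solve-∀

    nonNegative⇒inequalities : ∀ {a : Point t} → Residues t a →
      NonNegative (aToZ s a) → CoreInequalities t s a
    nonNegative⇒inequalities {a} residue z≥0 i = ≤-by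
      (subst (0ℤ * + t ≤_) (aToZ-exact a residue j)
        (ℤ.*-monoʳ-≤-nonNeg (+ t) (z≥0 (fromℕ< (n%ℕd<d j t)))))
      (trans (cong₂ (λ x y → (x - (y - + s)) - 0ℤ * + t)
        (sym ([]≡walk a i)) ([]-cong a next≈))
        (eq (a [ i ]) (a [ i + + s ]) (+ s) (+ t)))
      where
      j = e * (i - k)
      next≈ : + s * (j + 1ℤ) + k ≈ i + + s mod t
      next≈ = mod-trans (mod-reflexive (eq₁ (+ s) j k))
        (mod-+ (index≈ i) (mod-reflexive refl))
        where
        eq₁ : ∀ s j k → s * (j + 1ℤ) + k ≡ (s * j + k) + s
        eq₁ = solve-∀
      eq : ∀ a b s t → (a - (b - s)) - 0ℤ * t ≡ a - (b - s)
      eq = solve-∀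

    inequalities⇒nonNegative : ∀ {a : Point t} → Residues t a →
      CoreInequalities t s a → NonNegative (aToZ s a)
    inequalities⇒nonNegative {a} residue ineq i = 0≤*⇒0≤ t
      (subst (0ℤ ≤_) (sym (aToZ-exact-Fin a residue i))
        (ℤ.i≤j⇒0≤j-i (subst (λ x → a [ x ] - + s ≤ walk a (+ toℕ i))
          (eq (+ s) (+ toℕ i) k) (ineq (+ s * + toℕ i + k)))))
      where
      eq : ∀ s j k → (s * j + k) + s ≡ s * (j + 1ℤ) + k
      eq = solve-∀

-- Pair the terms i and t - i.
symmetric⇒2*weighted : ∀ t .{{_ : NonZero t}} (z : Point t) → ZSymmetric t z →
  + 2 * ∑ (λ i → + toℕ i * z i) ≡ + t * (∑ z - z [ 0ℤ ])
symmetric⇒2*weighted (suc m) z sym-z = begin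
  + 2 * (0ℤ * z zero + ∑ w)          ≡⟨ eq₁ (z zero) (∑ w) ⟩
  ∑ w + ∑ w                          ≡⟨ cong (_+_ (∑ w)) (∑-opposite w) ⟩
  ∑ w + ∑ (w ∘ Fin.opposite)         ≡⟨ sym (∑-distrib-+ w (w ∘ Fin.opposite)) ⟩
  ∑ (λ i → w i + w (Fin.opposite i)) ≡⟨ ∑-cong pair ⟩
  ∑ (λ i → z (suc i) * + suc m)      ≡⟨ sym (∑-* (z ∘ suc) (+ suc m)) ⟩
  ∑ (z ∘ suc) * + suc m              ≡⟨ eq₂ (z zero) (∑ (z ∘ suc)) (+ suc m) ⟩
  + suc m * (∑ z - z zero)           ≡⟨ cong (λ x → + suc m * (∑ z - x)) (sym ([]-toℕ z zero)) ⟩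
  + suc m * (∑ z - z [ 0ℤ ])         ∎
  where
  open ≡-Reasoning
  w : Fin m → ℤ
  w i = + suc (toℕ i) * z (suc i)
  eq₁ : ∀ z w → + 2 * (0ℤ * z + w) ≡ w + w
  eq₁ = solve-∀
  eq₂ : ∀ z x t → x * t ≡ t * ((z + x) - z)
  eq₂ = solve-∀
  eq₃ : ∀ m i → 1ℤ + (m - (1ℤ + i)) ≡ - (1ℤ + i) + 1ℤ * (1ℤ + m)
  eq₃ = solve-∀
  eq₄ : ∀ m i x → (1ℤ + i) * x + (1ℤ + (m - (1ℤ + i))) * x ≡ x * (1ℤ + m)
  eq₄ = solve-∀
  opposite≡ : ∀ i → + suc (toℕ (Fin.opposite i)) ≡ 1ℤ + (+ m - + suc (toℕ i))
  opposite≡ i = cong (_+_ 1ℤ)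
    (trans (cong +_ (Fin.opposite-prop i)) (+-∸ (Fin.toℕ<n i)))
  z-opposite : ∀ i → z (suc (Fin.opposite i)) ≡ z (suc i)
  z-opposite i = trans (sym ([]-toℕ z (suc (Fin.opposite i))))
    (trans ([]-cong z (mod-trans (mod-reflexive (trans (opposite≡ i) (eq₃ (+ m) (+ toℕ i))))
        (mod-shift (- + suc (toℕ i)) 1ℤ)))
      (trans (sym (sym-z (+ suc (toℕ i)))) ([]-toℕ z (suc i))))
  pair : ∀ i → w i + w (Fin.opposite i) ≡ z (suc i) * + suc m
  pair i = trans (cong₂ (λ x y → w i + x * y) (opposite≡ i) (z-opposite i))
    (eq₄ (+ m) (+ toℕ i) (z (suc i)))

-- The inverse of `aToZ`: the walk with steps s - t z_j and starting point
-- k - ∑ j z_j, cf. `aToZ-weighted`.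

module FromZ (s t : ℕ) .{{_ : NonZero t}} (coprime : Coprime s t)
             (z : Point t) (z∈ : UAll t s z) where

  private
    k = + shift s t
    e = proj₁ (inverse {s} {t} coprime)
    W = ∑ (λ i → + toℕ i * z i)

    es≈1 : e * + s ≈ 1ℤ mod t
    es≈1 = proj₂ (inverse {s} {t} coprime)

    2k≡ : + 2 * k ≡ (1ℤ + + s) * (+ t - 1ℤ)
    2k≡ = 2*shift coprime

    sum-z : ∑ z ≡ + s
    sum-z = proj₁ z∈

    W≈0 : W ≈ 0ℤ mod t
    W≈0 = mod (proj₁ (proj₂ z∈))

    sym-z : ZSymmetric t z
    sym-z = proj₂ (proj₂ z∈)

  path : ℕ → ℤ
  path zero    = k - W
  path (suc n) = path n + + s - z [ + n ] * + t

  -- The total displacement over t steps is s t - t ∑ z, which is 0 because ∑ z = s.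
  path-period : path t ≡ path 0
  path-period = sym (≡-by (begin
    path 0 - path t
      ≡⟨ sym (∑-telescope t path) ⟩
    ∑ {t} (λ i → path (toℕ i) - path (suc (toℕ i)))
      ≡⟨ ∑-cong {t} term ⟩
    ∑ (λ i → z i * + t + - + s)
      ≡⟨ ∑-distrib-+ (λ i → z i * + t) (λ _ → - + s) ⟩
    ∑ (λ i → z i * + t) + ∑ {t} (λ _ → - + s)
      ≡⟨ cong₂ _+_ (sym (∑-* z (+ t))) (∑-const t (- + s)) ⟩
    ∑ z * + t + + t * - + s
      ≡⟨ cong (λ x → x * + t + + t * - + s) sum-z ⟩
    + s * + t + + t * - + s
      ≡⟨ eq₂ (+ s) (+ t) ⟩
    0ℤ ∎) (ℤ.+-identityʳ (path 0 - path t)))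
    where
    open ≡-Reasoning
    eq₁ : ∀ p s x → p - (p + s - x) ≡ x + - s
    eq₁ = solve-∀
    eq₂ : ∀ s t → s * t + t * - s ≡ 0ℤ
    eq₂ = solve-∀
    term : ∀ (i : Fin t) → path (toℕ i) - path (suc (toℕ i)) ≡ z i * + t + - + s
    term i = trans (eq₁ (path (toℕ i)) (+ s) (z [ + toℕ i ] * + t))
      (cong (λ x → x * + t + - + s) ([]-toℕ z i))

  path≈ : ∀ n → path n ≈ k + + s * + n mod t
  path≈ zero = mod-trans (mod-+ (mod-reflexive {x = k} refl) (mod-neg W≈0))
    (mod-reflexive (eq k (+ s)))
    where
    eq : ∀ k s → k - 0ℤ ≡ k + s * 0ℤ
    eq = solve-∀
  path≈ (suc n) = mod-trans (mod-reflexive (eq₁ (path n) (+ s) (z [ + n ]) (+ t)))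
    (mod-trans (mod-shift (path n + + s) (- z [ + n ]))
      (mod-trans (mod-+ (path≈ n) (mod-reflexive refl))
        (mod-reflexive (eq₂ k (+ s) (+ n)))))
    where
    eq₁ : ∀ p s x t → p + s - x * t ≡ p + s + - x * t
    eq₁ = solve-∀
    eq₂ : ∀ k s n → k + s * n + s ≡ k + s * (1ℤ + n)
    eq₂ = solve-∀

  g : ℤ → ℤ
  g j = path (j %ℕ t)

  g-cong : ∀ {i j} → i ≈ j mod t → g i ≡ g j
  g-cong i≈j = cong path (%-cong i≈j)

  g≈ : ∀ j → g j ≈ k + + s * j mod t
  g≈ j = mod-trans (path≈ (j %ℕ t))
    (mod-+ (mod-reflexive {x = k} refl) (mod-* (+ s) (mod-% j)))

  g-step : ∀ j → g (j + 1ℤ) ≡ g j + + s - z [ j ] * + t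
  g-step j = trans (step (j %ℕ t) (n%ℕd<d j t) (mod-sym (mod-% j)))
    (cong (λ x → g j + + s - x * + t) ([]-cong z (mod-% j)))
    where
    -- Only the last residue r = t - 1 wraps around; there `path-period` closes the walk.
    step : ∀ r → r ℕ.< t → j ≈ + r mod t → g (j + 1ℤ) ≡ path (suc r)
    step r r<t j≈r = [ (λ 1+r<t → cong path (trans (%-cong j+1≈) (%-small 1+r<t)))
                     , (λ 1+r≡t → trans (cong path (trans (%-cong (mod-trans j+1≈
                         (mod-trans (mod-reflexive (cong +_ 1+r≡t)) t≈0)))
                         (%-small (ℕ.>-nonZero⁻¹ t))))
                         (trans (sym path-period) (cong path (sym 1+r≡t))))
                     ]′ (ℕ.m≤n⇒m<n∨m≡n r<t)
      where
      j+1≈ : j + 1ℤ ≈ + suc r mod t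
      j+1≈ = mod-trans (mod-+ j≈r (mod-reflexive {x = 1ℤ} refl))
        (mod-reflexive (ℤ.+-comm (+ r) 1ℤ))
      t≈0 : + t ≈ 0ℤ mod t
      t≈0 = mod-trans (mod-reflexive (sym (trans (ℤ.+-identityˡ _) (ℤ.*-identityˡ (+ t)))))
        (mod-shift 0ℤ 1ℤ)

  g-start : g 0ℤ ≡ k - W
  g-start = cong path (%-small (ℕ.>-nonZero⁻¹ t))

  g-reflect : ∀ j → g j + g (1ℤ - j) ≡ + t - 1ℤ
  g-reflect = induction-ℤ/t t
    (λ {i} {j} i≈j p → trans (sym (cong₂ _+_ (g-cong i≈j)
      (g-cong {1ℤ - i} {1ℤ - j} (mod-+ (mod-reflexive {x = 1ℤ} refl) (mod-neg i≈j))))) p)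
    start step
    where
    start : g 0ℤ + g 1ℤ ≡ + t - 1ℤ
    start = begin
      g 0ℤ + g 1ℤ
        ≡⟨ cong₂ _+_ g-start (trans (g-step 0ℤ)
             (cong (λ x → x + + s - z [ 0ℤ ] * + t) g-start)) ⟩
      (k - W) + (k - W + + s - z [ 0ℤ ] * + t)
        ≡⟨ eq₁ k W (+ s) (z [ 0ℤ ] * + t) ⟩
      + 2 * k - + 2 * W + + s - z [ 0ℤ ] * + t
        ≡⟨ cong₂ (λ x y → x - y + + s - z [ 0ℤ ] * + t) 2k≡
             (trans (symmetric⇒2*weighted t z sym-z)
               (cong (λ x → + t * (x - z [ 0ℤ ])) sum-z)) ⟩
      (1ℤ + + s) * (+ t - 1ℤ) - + t * (+ s - z [ 0ℤ ]) + + s - z [ 0ℤ ] * + t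
        ≡⟨ eq₂ (+ s) (+ t) (z [ 0ℤ ]) ⟩
      + t - 1ℤ ∎
      where
      open ≡-Reasoning
      eq₁ : ∀ k w s x → (k - w) + (k - w + s - x) ≡ + 2 * k - + 2 * w + s - x
      eq₁ = solve-∀
      eq₂ : ∀ s t x → (1ℤ + s) * (t - 1ℤ) - t * (s - x) + s - x * t ≡ t - 1ℤ
      eq₂ = solve-∀
    step : ∀ j → g j + g (1ℤ - j) ≡ + t - 1ℤ →
           g (j + 1ℤ) + g (1ℤ - (j + 1ℤ)) ≡ + t - 1ℤ
    step j p = begin
      g (j + 1ℤ) + g (1ℤ - (j + 1ℤ))
        ≡⟨ cong₂ _+_ (g-step j) (cong g (eq₁ j)) ⟩
      g j + + s - z [ j ] * + t + g (- j)
        ≡⟨ cong (λ x → g j + + s - x * + t + g (- j)) (sym-z j) ⟩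
      g j + + s - z [ - j ] * + t + g (- j)
        ≡⟨ eq₂ (g j) (+ s) (z [ - j ] * + t) (g (- j)) ⟩
      g j + (g (- j) + + s - z [ - j ] * + t)
        ≡⟨ cong (_+_ (g j)) (sym (g-step (- j))) ⟩
      g j + g (- j + 1ℤ)
        ≡⟨ cong (λ i → g j + g i) (ℤ.+-comm (- j) 1ℤ) ⟩
      g j + g (1ℤ - j)
        ≡⟨ p ⟩
      + t - 1ℤ ∎
      where
      open ≡-Reasoning
      eq₁ : ∀ j → 1ℤ - (j + 1ℤ) ≡ - j
      eq₁ = solve-∀
      eq₂ : ∀ a s x b → a + s - x + b ≡ a + (b + s - x)
      eq₂ = solve-∀

  coordinate : ℤ → ℤ
  coordinate i = g (e * (i - k))

  coordinate-cong : ∀ {i j} → i ≈ j mod t → coordinate i ≡ coordinate j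
  coordinate-cong {i} {j} i≈j = g-cong {e * (i - k)} {e * (j - k)}
    (mod-* e (mod-+ i≈j (mod-reflexive refl)))

  a : Point t
  a i = coordinate (+ toℕ i)

  a-[] : ∀ i → a [ i ] ≡ coordinate i
  a-[] = []-tabulate {f = coordinate} coordinate-cong

  a-residues : Residues t a
  a-residues i = unmod (mod-trans (mod-reflexive (a-[] i))
    (mod-trans (g≈ (e * (i - k))) (mod-trans
      (mod-reflexive (ℤ.+-comm k (+ s * (e * (i - k))))) (index≈ s t coprime i))))

  a-symmetric : ASymmetric t a
  a-symmetric i = trans (cong₂ _+_ (a-[] i) (trans (a-[] (-1ℤ - i)) (g-cong reflect)))
    (g-reflect (e * (i - k)))
    where
    eq₁ : ∀ e i k → e * ((-1ℤ - i) - k) ≡ - (e * (1ℤ + + 2 * k)) - e * (i - k)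
    eq₁ = solve-∀
    eq₂ : ∀ e s t → - (e * (1ℤ + (1ℤ + s) * (t - 1ℤ))) ≡ e * s + - (e * (1ℤ + s)) * t
    eq₂ = solve-∀
    -- Since 1 + 2k = t(s + 1) - s, the factor -e(1 + 2k) is congruent to e s, that is, to 1.
    reflect : e * ((-1ℤ - i) - k) ≈ 1ℤ - e * (i - k) mod t
    reflect = mod-trans (mod-reflexive (eq₁ e i k)) (mod-+ {y = - (e * (i - k))}
      (mod-trans (mod-reflexive (trans (cong (λ x → - (e * (1ℤ + x))) 2k≡) (eq₂ e (+ s) (+ t))))
        (mod-trans (mod-shift (e * + s) (- (e * (1ℤ + + s)))) es≈1))
      (mod-reflexive refl))

  a∈ : BAll t a
  a∈ = symmetric⇒sumBinomial t a-symmetric , a-residues , a-symmetric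

  aToZ-a : ∀ i → aToZ s a i ≡ z i
  aToZ-a i = /ℕ-unique (begin
    walk s t a j - (walk s t a (j + 1ℤ) - + s)
      ≡⟨ cong₂ (λ x y → x - (y - + s)) (walk≡ j) (trans (walk≡ (j + 1ℤ)) (g-step j)) ⟩
    g j - (g j + + s - z [ j ] * + t - + s)
      ≡⟨ eq (g j) (+ s) (z [ j ] * + t) ⟩
    z [ j ] * + t
      ≡⟨ cong (_* + t) ([]-toℕ z i) ⟩
    z i * + t ∎)
    where
    open ≡-Reasoning
    j = + toℕ i
    walk≡ : ∀ j → walk s t a j ≡ g j
    walk≡ j = trans (a-[] (+ s * j + k)) (g-cong (index⁻¹≈ s t coprime j))
    eq : ∀ g s x → g - (g + s - x - s) ≡ x
    eq = solve-∀

-- The change from z- to u-coordinates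

rangeSum : ℕ → (ℕ → ℤ) → ℤ
rangeSum n f = ∑ {n} (f ∘ toℕ)

rangeSum-split : ∀ m n f → rangeSum (m ℕ.+ n) f ≡
                 rangeSum m f + rangeSum n (λ i → f (m ℕ.+ i))
rangeSum-split zero    n f = sym (ℤ.+-identityˡ (rangeSum n f))
rangeSum-split (suc m) n f = trans (cong (_+_ (f 0)) (rangeSum-split m n (f ∘ suc)))
  (sym (ℤ.+-assoc (f 0) _ _))

rangeSum-last : ∀ n f → rangeSum (suc n) f ≡ rangeSum n f + f n
rangeSum-last n f = trans (cong (λ m → rangeSum m f) (ℕ.+-comm 1 n))
  (trans (rangeSum-split n 1 f) (cong (_+_ (rangeSum n f))
    (trans (ℤ.+-identityʳ _) (cong f (ℕ.+-identityʳ n)))))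

module _ {t : ℕ} {f : ℕ → ℤ} (reflect : ∀ m n → m ℕ.+ n ≡ t → f m ≡ f n) where

  -- The indices n, ..., t - 1 reflect to m, ..., 1: the same values are summed in reverse order.
  rangeSum-reflect : ∀ m n → n ℕ.+ m ≡ t →
                     rangeSum m (λ i → f (n ℕ.+ i)) ≡ rangeSum m (f ∘ suc)
  rangeSum-reflect m n n+m≡t = trans (∑-opposite {m} (λ i → f (n ℕ.+ toℕ i)))
    (∑-cong λ i → reflect _ _ (begin
      n ℕ.+ toℕ (Fin.opposite i) ℕ.+ suc (toℕ i)
        ≡⟨ cong (λ x → n ℕ.+ x ℕ.+ suc (toℕ i)) (Fin.opposite-prop i) ⟩
      n ℕ.+ (m ℕ.∸ suc (toℕ i)) ℕ.+ suc (toℕ i)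
        ≡⟨ ℕ.+-assoc n _ _ ⟩
      n ℕ.+ (m ℕ.∸ suc (toℕ i) ℕ.+ suc (toℕ i))
        ≡⟨ cong (n ℕ.+_) (ℕ.m∸n+n≡m (Fin.toℕ<n i)) ⟩
      n ℕ.+ m
        ≡⟨ n+m≡t ⟩
      t ∎))
    where open ≡-Reasoning

  fold-odd : ∀ m → t ≡ suc (m ℕ.+ m) →
             rangeSum t f ≡ f 0 + + 2 * rangeSum m (f ∘ suc)
  fold-odd m t≡ = trans (cong (λ n → rangeSum n f) t≡) (cong (_+_ (f 0))
    (trans (rangeSum-split m m (f ∘ suc))
      (trans (cong (_+_ (rangeSum m (f ∘ suc))) (rangeSum-reflect m (suc m) (sym t≡)))
        (eq (rangeSum m (f ∘ suc))))))
    where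
    eq : ∀ x → x + x ≡ + 2 * x
    eq = solve-∀

  -- Here t = 2(m + 1), and m + 1 is its own reflection, so its term stays unpaired.
  fold-even : ∀ m → t ≡ suc (m ℕ.+ suc m) →
              rangeSum t f ≡ f 0 + (+ 2 * rangeSum m (f ∘ suc) + f (suc m))
  fold-even m t≡ = trans (cong (λ n → rangeSum n f) t≡) (cong (_+_ (f 0)) (begin
    rangeSum (m ℕ.+ suc m) (f ∘ suc)
      ≡⟨ rangeSum-split m (suc m) (f ∘ suc) ⟩
    r + (f (suc (m ℕ.+ 0)) + rangeSum m (λ i → f (suc (m ℕ.+ suc i))))
      ≡⟨ cong₂ (λ x y → r + (x + y)) (cong (f ∘ suc) (ℕ.+-identityʳ m))
           (trans (∑-cong {m} (λ i → cong (f ∘ suc) (ℕ.+-suc m (toℕ i))))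
             (rangeSum-reflect m (suc (suc m))
               (trans (cong suc (sym (ℕ.+-suc m m))) (sym t≡)))) ⟩
    r + (f (suc m) + r)
      ≡⟨ eq r (f (suc m)) ⟩
    + 2 * r + f (suc m) ∎))
    where
    open ≡-Reasoning
    r = rangeSum m (f ∘ suc)
    eq : ∀ x y → x + (y + x) ≡ + 2 * x + y
    eq = solve-∀

data HalfView (t : ℕ) : Set where
  odd  : ∀ m → t ≡ suc (m ℕ.+ m) → ⌊ t /2⌋ ≡ m → ¬ 2 ℕ.∣ t → HalfView t
  even : ∀ m → t ≡ suc (m ℕ.+ suc m) → ⌊ t /2⌋ ≡ suc m → 2 ℕ.∣ t → HalfView t

halfView : ∀ t .{{_ : NonZero t}} → HalfView t
halfView 1 = odd 0 refl refl λ 2∣1 → contradiction (ℕ.∣1⇒≡1 2∣1) λ ()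
halfView 2 = even 0 refl refl ℕ.∣-refl
halfView (suc (suc t@(suc _))) with halfView t
... | odd m t≡ half ¬2∣t = odd (suc m)
  (cong (λ n → suc (suc n)) (trans t≡ (sym (ℕ.+-suc m m)))) (cong suc half)
  (λ 2∣2+t → ¬2∣t (ℕ.∣m+n∣m⇒∣n 2∣2+t ℕ.∣-refl))
... | even m t≡ half 2∣t = even (suc m)
  (cong (λ n → suc (suc n)) (trans t≡ (sym (ℕ.+-suc m (suc m))))) (cong suc half)
  (ℕ.∣m∣n⇒∣m+n ℕ.∣-refl 2∣t)

-- Generic in the two decisions made by `zToU`, so that matching on them reduces
-- the conditional.

module _ {X Y : Set} (X? : Dec X) (Y? : Dec Y) where

  halveIf doubleIf : ℤ → ℤ
  halveIf  x = if does X? ∧ does Y? then x /ℕ 2 else x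
  doubleIf x = if does X? ∧ does Y? then x * + 2 else x

module _ {X Y : Set} where

  halveIf-yes : ∀ (X? : Dec X) (Y? : Dec Y) x → X → Y → halveIf X? Y? x ≡ x /ℕ 2
  halveIf-yes (yes _) (yes _) x a b = refl
  halveIf-yes (yes _) (no ¬b) x a b = contradiction b ¬b
  halveIf-yes (no ¬a) _       x a b = contradiction a ¬a

  halveIf-no : ∀ (X? : Dec X) (Y? : Dec Y) x → ¬ (X × Y) → halveIf X? Y? x ≡ x
  halveIf-no (yes a) (yes b) x ¬ab = contradiction (a , b) ¬ab
  halveIf-no (yes _) (no _)  x ¬ab = refl
  halveIf-no (no _)  _       x ¬ab = refl

  halveIf-nonNegative : ∀ (X? : Dec X) (Y? : Dec Y) x → 0ℤ ≤ x → 0ℤ ≤ halveIf X? Y? x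
  halveIf-nonNegative (yes _) (yes _) x x≥0 = 0≤n⇒0≤n/ℕd x 2 x≥0
  halveIf-nonNegative (yes _) (no _)  x x≥0 = x≥0
  halveIf-nonNegative (no _)  _       x x≥0 = x≥0

  doubleIf-nonNegative : ∀ (X? : Dec X) (Y? : Dec Y) x → 0ℤ ≤ x → 0ℤ ≤ doubleIf X? Y? x
  doubleIf-nonNegative (yes _) (yes _) x x≥0 = ℤ.*-monoʳ-≤-nonNeg (+ 2) x≥0
  doubleIf-nonNegative (yes _) (no _)  x x≥0 = x≥0
  doubleIf-nonNegative (no _)  _       x x≥0 = x≥0

  halve-double : ∀ (X? : Dec X) (Y? : Dec Y) x → halveIf X? Y? (doubleIf X? Y? x) ≡ x
  halve-double (yes _) (yes _) x = /ℕ-unique {2} refl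
  halve-double (yes _) (no _)  x = refl
  halve-double (no _)  _       x = refl

  double-halve : ∀ (X? : Dec X) (Y? : Dec Y) x → (X → Y → + 2 ∣ x) →
                 doubleIf X? Y? (halveIf X? Y? x) ≡ x
  double-halve (yes a) (yes b) x 2∣x = /ℕ-exact {2} (2∣x a b)
  double-halve (yes _) (no _)  x 2∣x = refl
  double-halve (no _)  _       x 2∣x = refl

  doubleIf-even : ∀ (X? : Dec X) (Y? : Dec Y) x → X → Y → + 2 ∣ doubleIf X? Y? x
  doubleIf-even (yes _) (yes _) x a b = divides x refl
  doubleIf-even (yes _) (no ¬b) x a b = contradiction b ¬b
  doubleIf-even (no ¬a) _       x a b = contradiction a ¬a

/ℕ-floor : ∀ {t} .{{_ : NonZero t}} {n q r} → r ℕ.< t → n ≡ + r + q * + t → n /ℕ t ≡ q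
/ℕ-floor {t} {n} {q} {r} r<t n≡ = *t-cancel (≡-by
  (trans (cong (λ x → + x + (n /ℕ t) * + t) (sym remainder≡))
    (trans (sym (a≡a%ℕn+[a/ℕn]*n n t)) n≡))
  (eq (+ r) ((n /ℕ t) * + t) (q * + t)))
  where
  eq : ∀ r x y → (r + x) - (r + y) ≡ x - y
  eq = solve-∀
  remainder≡ : n %ℕ t ≡ r
  remainder≡ = mod-unique (n%ℕd<d n t) r<t
    (mod-trans (mod-% n) (mod-trans (mod-reflexive n≡) (mod-shift (+ r) q)))

⌊/2⌋≡/ℕ2 : ∀ n → + n /ℕ 2 ≡ + ⌊ n /2⌋
⌊/2⌋≡/ℕ2 n = /ℕ-floor (proj₁ (proj₂ (go n))) (proj₂ (proj₂ (go n)))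
  where
  eq : ∀ r q → 1ℤ + (1ℤ + (r + q * + 2)) ≡ r + (1ℤ + q) * + 2
  eq = solve-∀
  go : ∀ n → ∃ λ r → r ℕ.< 2 × + n ≡ + r + + ⌊ n /2⌋ * + 2
  go 0 = 0 , ℕ.s≤s ℕ.z≤n , refl
  go 1 = 1 , ℕ.s≤s (ℕ.s≤s ℕ.z≤n) , refl
  go (suc (suc n)) with go n
  ... | r , r<2 , e = r , r<2 , trans (cong (λ x → 1ℤ + (1ℤ + x)) e) (eq (+ r) (+ ⌊ n /2⌋))

module _ (t : ℕ) .{{_ : NonZero t}} where

  private
    t′ = ⌊ t /2⌋

  -- Up to sign, the residues are 0, …, t′.
  induction-± : {P : Pred ℤ 0ℓ} → (∀ {i j} → i ≈ j mod t → P i → P j) →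
    (∀ {i} → P i → P (- i)) → P 0ℤ → (∀ (i : Fin t′) → P (+ suc (toℕ i))) → ∀ i → P i
  induction-± {P} resp neg p0 p i = resp (mod-% i) (go (i %ℕ t) (n%ℕd<d i t))
    where
    small : ∀ n → n ℕ.≤ t′ → P (+ n)
    small zero    n≤ = p0
    small (suc n) n≤ = subst (λ m → P (+ suc m)) (Fin.toℕ-fromℕ< n≤) (p (fromℕ< n≤))

    -≈ : ∀ n → n ℕ.≤ t → - + (t ℕ.∸ n) ≈ + n mod t
    -≈ n n≤t = mod-trans (mod-reflexive (trans (cong -_ (+-∸ n≤t)) (eq (+ t) (+ n))))
      (mod-shift (+ n) -1ℤ)
      where
      eq : ∀ t n → - (t - n) ≡ n + -1ℤ * t
      eq = solve-∀

    complement : ∀ n → n ℕ.< t → ¬ n ℕ.≤ t′ → t ℕ.∸ n ℕ.≤ t′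
    complement n n<t n≰ = ℕ.m≤n+o⇒m∸n≤o t n (ℕ.≤-trans
      (ℕ.≤-reflexive (sym (ℕ.⌊n/2⌋+⌈n/2⌉≡n t)))
      (ℕ.≤-trans (ℕ.+-monoʳ-≤ t′ (ℕ.≤-trans (⌈/2⌉≤ t) (ℕ.≰⇒> n≰)))
        (ℕ.≤-reflexive (ℕ.+-comm t′ n))))
      where
      ⌈/2⌉≤ : ∀ n → ℕ.⌈ n /2⌉ ℕ.≤ suc ⌊ n /2⌋
      ⌈/2⌉≤ 0             = ℕ.z≤n
      ⌈/2⌉≤ 1             = ℕ.≤-refl
      ⌈/2⌉≤ (suc (suc n)) = ℕ.s≤s (⌈/2⌉≤ n)

    go : ∀ n → n ℕ.< t → P (+ n)
    go n n<t with n ℕ.≤? t′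
    ... | yes n≤ = small n n≤
    ... | no n≰ = resp (-≈ n (ℕ.<⇒≤ n<t)) (neg (small (t ℕ.∸ n) (complement n n<t n≰)))

  symmetric⇒reflect : ∀ (z : Point t) → ZSymmetric t z →
                      ∀ m n → m ℕ.+ n ≡ t → z [ + m ] ≡ z [ + n ]
  symmetric⇒reflect z sym-z m n m+n≡t = trans (sym-z (+ m)) ([]-cong z (mod-trans
    (mod-reflexive (trans (eq (+ m) (+ n)) (cong (λ x → + n + -1ℤ * x) (cong +_ m+n≡t))))
    (mod-shift (+ n) -1ℤ)))
    where
    eq : ∀ m n → - m ≡ n + -1ℤ * (m + n)
    eq = solve-∀

  ∑≡rangeSum : ∀ (z : Point t) → ∑ z ≡ rangeSum t (λ n → z [ + n ])
  ∑≡rangeSum z = ∑-cong {t} (λ i → sym ([]-toℕ z i))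

  -- `half z r` is u_r for 1 ≤ r ≤ t′; r = 0 and r > t′ are junk.
  half : Point t → ℕ → ℤ
  half z r = halveIf (2 ℕ.∣? t) (r ℕ.≟ t′) (z [ + r ])

  EvenMiddle : Pred (Point t) 0ℓ
  EvenMiddle z = 2 ℕ.∣ t → + 2 ∣ z [ + t′ ]

  -- Paired indices contribute twice. For even t the unpaired middle term is twice its exact half,
  -- so both parities of t lead to one formula.
  half-sum : ∀ z → ZSymmetric t z → EvenMiddle z →
             ∑ z ≡ z [ 0ℤ ] + + 2 * rangeSum t′ (half z ∘ suc)
  half-sum z sym-z mid with halfView t
  ... | odd m t≡ t′≡ ¬2∣t = begin
    ∑ z
      ≡⟨ ∑≡rangeSum z ⟩
    rangeSum t f
      ≡⟨ fold-odd (symmetric⇒reflect z sym-z) m t≡ ⟩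
    f 0 + + 2 * rangeSum m (f ∘ suc)
      ≡⟨ cong₂ (λ n x → f 0 + + 2 * x) (sym t′≡) (∑-cong {m} (λ i → sym
           (halveIf-no (2 ℕ.∣? t) (suc (toℕ i) ℕ.≟ t′) (f (suc (toℕ i))) (¬2∣t ∘ proj₁)))) ⟩
    f 0 + + 2 * rangeSum m (half z ∘ suc)
      ≡⟨ cong (λ n → f 0 + + 2 * rangeSum n (half z ∘ suc)) (sym t′≡) ⟩
    f 0 + + 2 * rangeSum t′ (half z ∘ suc) ∎
    where
    open ≡-Reasoning
    f : ℕ → ℤ
    f n = z [ + n ]
  ... | even m t≡ t′≡ 2∣t = begin
    ∑ z
      ≡⟨ ∑≡rangeSum z ⟩
    rangeSum t f
      ≡⟨ fold-even (symmetric⇒reflect z sym-z) m t≡ ⟩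
    f 0 + (+ 2 * rangeSum m (f ∘ suc) + f (suc m))
      ≡⟨ cong₂ (λ x y → f 0 + (+ 2 * x + y))
           (∑-cong {m} (λ i → sym (halveIf-no (2 ℕ.∣? t) (suc (toℕ i) ℕ.≟ t′) _
             (λ (_ , i≡t′) → ℕ.<⇒≢ (Fin.toℕ<n i) (ℕ.suc-injective (trans i≡t′ t′≡))))))
           (sym middle) ⟩
    f 0 + (+ 2 * rangeSum m (half z ∘ suc) + half z (suc m) * + 2)
      ≡⟨ eq (f 0) (rangeSum m (half z ∘ suc)) (half z (suc m)) ⟩
    f 0 + + 2 * (rangeSum m (half z ∘ suc) + half z (suc m))
      ≡⟨ cong (λ x → f 0 + + 2 * x) (sym (rangeSum-last m (half z ∘ suc))) ⟩
    f 0 + + 2 * rangeSum (suc m) (half z ∘ suc)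
      ≡⟨ cong (λ n → f 0 + + 2 * rangeSum n (half z ∘ suc)) (sym t′≡) ⟩
    f 0 + + 2 * rangeSum t′ (half z ∘ suc) ∎
    where
    open ≡-Reasoning
    f : ℕ → ℤ
    f n = z [ + n ]
    middle : half z (suc m) * + 2 ≡ f (suc m)
    middle = trans (cong (_* + 2) (halveIf-yes (2 ℕ.∣? t) (suc m ℕ.≟ t′) _ 2∣t (sym t′≡)))
      (/ℕ-exact (subst (λ n → + 2 ∣ z [ + n ]) t′≡ (mid 2∣t)))
    eq : ∀ x y z → x + (+ 2 * y + z * + 2) ≡ x + + 2 * (y + z)
    eq = solve-∀

  module _ (s : ℕ) where

    -- If t is even, then ∑ i z_i = t (s - z_0) / 2 is a multiple of t only if
    -- s - z_0 is even.
    UAll⇒evenMiddle : ∀ z → UAll t s z → EvenMiddle z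
    UAll⇒evenMiddle z (sum-z , mod-W , sym-z) 2∣t = go (halfView t) mod-W
      where
      open ≡-Reasoning
      f : ℕ → ℤ
      f n = z [ + n ]
      W = ∑ (λ i → + toℕ i * z i)
      go : HalfView t → WeightedSum t z → + 2 ∣ z [ + t′ ]
      go (odd _ _ _ ¬2∣t) _ = contradiction 2∣t ¬2∣t
      go (even m t≡ t′≡ _) (divides q W-0≡qt) = subst (λ n → + 2 ∣ f n) (sym t′≡)
        -- With q t the weighted sum, pairing gives s - z_0 = 2q, while direct summation gives s -
        -- z_0 = 2r + z_{t'}.
        (divides (q - r) (≡-by₂ 2q≡ sum≡ (eq q r (f (suc m)) (f 0) (∑ z))))
        where
        r = rangeSum m (f ∘ suc)
        sum≡ : f 0 + (+ 2 * r + f (suc m)) ≡ ∑ z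
        sum≡ = sym (trans (∑≡rangeSum z) (fold-even (symmetric⇒reflect z sym-z) m t≡))
        2q≡ : ∑ z - f 0 ≡ q * + 2
        2q≡ = *t-cancel (begin
          (∑ z - f 0) * + t   ≡⟨ ℤ.*-comm (∑ z - f 0) (+ t) ⟩
          + t * (∑ z - f 0)   ≡⟨ sym (symmetric⇒2*weighted t z sym-z) ⟩
          + 2 * W             ≡⟨ cong (+ 2 *_) (trans (sym (ℤ.+-identityʳ W)) W-0≡qt) ⟩
          + 2 * (q * + t)     ≡⟨ eq₁ q (+ t) ⟩
          q * + 2 * + t       ∎)
          where
          eq₁ : ∀ q t → + 2 * (q * t) ≡ q * + 2 * t
          eq₁ = solve-∀
        eq : ∀ q r x y s → (s - y - q * + 2) + (y + (+ 2 * r + x) - s) ≡ x - (q - r) * + 2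
        eq = solve-∀

    zToU-cong : ∀ {z w : Point t} → (∀ i → z i ≡ w i) → ∀ i → zToU z i ≡ zToU w i
    zToU-cong z≗w zero    = cong (_/ℕ 2) (z≗w _)
    zToU-cong z≗w (suc i) = cong (halveIf (2 ℕ.∣? t) (suc (toℕ i) ℕ.≟ t′)) (z≗w _)

    -- The equation s = (z_0 mod 2) + 2(u_0 + ⋯ + u_{t'}) is a division with remainder by 2, so the
    -- sum of the u_i is the quotient ⌊s/2⌋.
    zToU-maps : ∀ {z} → UAll t s z → VAll t s (zToU z)
    zToU-maps {z} z∈@(sum-z , _ , sym-z) = sym (trans (sym (⌊/2⌋≡/ℕ2 s))
      (/ℕ-floor (n%ℕd<d (z [ 0ℤ ]) 2) (begin
        + s                                          ≡⟨ sym sum-z ⟩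
        ∑ z                                          ≡⟨ half-sum z sym-z (UAll⇒evenMiddle z z∈) ⟩
        z [ 0ℤ ] + + 2 * r                           ≡⟨ cong (_+ + 2 * r) (a≡a%ℕn+[a/ℕn]*n (z [ 0ℤ ]) 2) ⟩
        + (z [ 0ℤ ] %ℕ 2) + u₀ * + 2 + + 2 * r       ≡⟨ eq (+ (z [ 0ℤ ] %ℕ 2)) u₀ r ⟩
        + (z [ 0ℤ ] %ℕ 2) + (u₀ + r) * + 2           ∎)))
      where
      open ≡-Reasoning
      r = rangeSum t′ (half z ∘ suc)
      u₀ = z [ 0ℤ ] /ℕ 2
      eq : ∀ b u r → b + u * + 2 + + 2 * r ≡ b + (u + r) * + 2
      eq = solve-∀

    recover : ∀ z → UAll t s z → ∀ r →
              doubleIf (2 ℕ.∣? t) (r ℕ.≟ t′) (half z r) ≡ z [ + r ]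
    recover z z∈ r = double-halve (2 ℕ.∣? t) (r ℕ.≟ t′) (z [ + r ])
      (λ 2∣t r≡t′ → subst (λ n → + 2 ∣ z [ + n ]) (sym r≡t′) (UAll⇒evenMiddle z z∈ 2∣t))

    -- Halving loses the parity of z_0; so z_0 is recovered from the total s and the remaining
    -- coordinates.
    zToU-injective : ∀ {z w} → UAll t s z → UAll t s w →
                     (∀ i → zToU z i ≡ zToU w i) → ∀ i → z i ≡ w i
    zToU-injective {z} {w} z∈@(sum-z , _ , sym-z) w∈@(sum-w , _ , sym-w) u≡ =
      ext-[] (induction-±
        (λ i≈j p → trans (sym ([]-cong z i≈j)) (trans p ([]-cong w i≈j)))
        (λ {i} p → trans (sym (sym-z i)) (trans p (sym-w i)))
        (≡-by₂ (trans (sym (half-sum z sym-z (UAll⇒evenMiddle z z∈)))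
                 (trans sum-z (trans (sym sum-w) (half-sum w sym-w (UAll⇒evenMiddle w w∈)))))
               (cong (+ 2 *_) (∑-cong {t′} (λ i → sym (u≡ (suc i)))))
               (eq (z [ 0ℤ ]) (w [ 0ℤ ]) (rangeSum t′ (half z ∘ suc))
                 (rangeSum t′ (half w ∘ suc))))
        λ i → trans (sym (recover z z∈ (suc (toℕ i))))
          (trans (cong (doubleIf (2 ℕ.∣? t) (suc (toℕ i) ℕ.≟ t′)) (u≡ (suc i)))
            (recover w w∈ (suc (toℕ i)))))
      where
      eq : ∀ z w x y → (z + + 2 * x - (w + + 2 * y)) + (+ 2 * y - + 2 * x) ≡ z - w
      eq = solve-∀

    nonNegative⇒zToU : ∀ {z} → NonNegative z → NonNegative (zToU z)
    nonNegative⇒zToU {z} z≥0 zero    = 0≤n⇒0≤n/ℕd (z [ 0ℤ ]) 2 (z≥0 _)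
    nonNegative⇒zToU {z} z≥0 (suc i) =
      halveIf-nonNegative (2 ℕ.∣? t) (suc (toℕ i) ℕ.≟ t′) _ (z≥0 _)

    zToU⇒nonNegative : ∀ {z} → UAll t s z → NonNegative (zToU z) → NonNegative z
    zToU⇒nonNegative {z} z∈@(_ , _ , sym-z) u≥0 i = subst (0ℤ ≤_) ([]-toℕ z i)
      (induction-± (λ i≈j → subst (0ℤ ≤_) ([]-cong z i≈j)) (λ {i} → subst (0ℤ ≤_) (sym-z i))
        (subst (0ℤ ≤_) (sym (a≡a%ℕn+[a/ℕn]*n (z [ 0ℤ ]) 2))
          (ℤ.+-mono-≤ (ℤ.+≤+ ℕ.z≤n) (ℤ.*-monoʳ-≤-nonNeg (+ 2) (u≥0 zero))))
        (λ i → subst (0ℤ ≤_) (recover z z∈ (suc (toℕ i)))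
          (doubleIf-nonNegative (2 ℕ.∣? t) (suc (toℕ i) ℕ.≟ t′) _ (u≥0 (suc i))))
        (+ toℕ i))

    module FromU (u : Point (suc t′)) (sum-u : VAll t s u) where

      middle : ℕ → ℤ
      middle r = doubleIf (2 ℕ.∣? t) (r ℕ.≟ t′) (u [ + r ])

      -- As s - z_0 has to be even, z_0 has the remainder of s modulo 2 and the quotient u_0. For 0
      -- < n < t, `n ⊓ (t ∸ n)` is the representative of ±n among 1, ..., t', which builds in the
      -- symmetry.
      coordinate : ℕ → ℤ
      coordinate zero      = + (+ s %ℕ 2) + u zero * + 2
      coordinate n@(suc _) = middle (n ℕ.⊓ (t ℕ.∸ n))

      coordinate-reflect : ∀ m n → 1 ℕ.≤ m → 1 ℕ.≤ n → m ℕ.+ n ≡ t →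
                           coordinate m ≡ coordinate n
      coordinate-reflect m@(suc _) n@(suc _) _ _ refl = cong middle
        (trans (cong (m ℕ.⊓_) (ℕ.m+n∸m≡n m n)) (trans (ℕ.⊓-comm m n)
          (cong (n ℕ.⊓_) (sym (ℕ.m+n∸n≡m m n)))))

      coordinate-small : ∀ r → 1 ℕ.≤ r → r ℕ.≤ t′ → coordinate r ≡ middle r
      coordinate-small r@(suc _) _ r≤t′ = cong middle (ℕ.m≤n⇒m⊓n≡m
        (ℕ.m+n≤o⇒m≤o∸n r (ℕ.≤-trans (ℕ.+-mono-≤ r≤t′ (ℕ.≤-trans r≤t′ (ℕ.⌊n/2⌋≤⌈n/2⌉ t)))
          (ℕ.≤-reflexive (ℕ.⌊n/2⌋+⌈n/2⌉≡n t)))))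

      z : Point t
      z i = coordinate (toℕ i)

      z-[] : ∀ n → n ℕ.< t → z [ + n ] ≡ coordinate n
      z-[] n n<t = cong coordinate
        (trans (Fin.toℕ-fromℕ< (n%ℕd<d (+ n) t)) (%-small n<t))

      t′<t : t′ ℕ.< t
      t′<t = subst (⌊ t /2⌋ ℕ.<_) (ℕ.suc-pred t)
        (subst (λ n → ⌊ n /2⌋ ℕ.< suc (ℕ.pred t)) (ℕ.suc-pred t) (ℕ.⌊n/2⌋<n (ℕ.pred t)))

      z-small : ∀ r → 1 ℕ.≤ r → r ℕ.≤ t′ → z [ + r ] ≡ middle r
      z-small r 1≤r r≤t′ =
        trans (z-[] r (ℕ.≤-<-trans r≤t′ t′<t)) (coordinate-small r 1≤r r≤t′)

      z-symmetric : ZSymmetric t z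
      z-symmetric i = trans ([]-cong z (mod-sym (mod-% i))) (trans
        (go (i %ℕ t) (n%ℕd<d i t)) ([]-cong z (mod-neg (mod-% i))))
        where
        go : ∀ n → n ℕ.< t → z [ + n ] ≡ z [ - + n ]
        go zero      n<t = refl
        go n@(suc _) n<t = trans (z-[] n n<t) (trans
          (coordinate-reflect n (t ℕ.∸ n) (ℕ.s≤s ℕ.z≤n) (ℕ.m<n⇒0<n∸m n<t)
            (ℕ.m+[n∸m]≡n (ℕ.<⇒≤ n<t)))
          (trans (sym (z-[] (t ℕ.∸ n) (ℕ.∸-monoʳ-< (ℕ.s≤s ℕ.z≤n) (ℕ.<⇒≤ n<t))))
            ([]-cong z (mod-trans (mod-reflexive (trans (+-∸ (ℕ.<⇒≤ n<t)) (eq (+ t) (+ n))))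
              (mod-shift (- + n) 1ℤ)))))
          where
          eq : ∀ t n → t - n ≡ - n + 1ℤ * t
          eq = solve-∀

      u-suc : ∀ i → u [ + suc (toℕ i) ] ≡ u (suc i)
      u-suc i = []-toℕ u (suc i)

      half-z : ∀ i → half z (suc (toℕ i)) ≡ u (suc i)
      half-z i = trans (cong (halveIf (2 ℕ.∣? t) (suc (toℕ i) ℕ.≟ t′))
          (z-small (suc (toℕ i)) (ℕ.s≤s ℕ.z≤n) (Fin.toℕ<n i)))
        (trans (halve-double (2 ℕ.∣? t) (suc (toℕ i) ℕ.≟ t′) (u [ + suc (toℕ i) ])) (u-suc i))

      z-0 : z [ 0ℤ ] ≡ + (+ s %ℕ 2) + u zero * + 2
      z-0 = z-[] 0 (ℕ.>-nonZero⁻¹ t)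

      zToU-z : ∀ i → zToU z i ≡ u i
      zToU-z zero    = /ℕ-floor (n%ℕd<d (+ s) 2) z-0
      zToU-z (suc i) = half-z i

      z-middle : EvenMiddle z
      z-middle 2∣t = subst (+ 2 ∣_) (sym (z-small t′ (ℕ.⌊n/2⌋-mono (ℕ.∣⇒≤ 2∣t)) ℕ.≤-refl))
        (doubleIf-even (2 ℕ.∣? t) (t′ ℕ.≟ t′) (u [ + t′ ]) 2∣t refl)

      z-sum : ∑ z ≡ z [ 0ℤ ] + + 2 * ∑ (u ∘ suc)
      z-sum = trans (half-sum z z-symmetric z-middle)
        (cong (λ x → z [ 0ℤ ] + + 2 * x) (∑-cong half-z))

      z-sumsTo : SumsTo s z
      z-sumsTo = begin
        ∑ z                                            ≡⟨ z-sum ⟩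
        z [ 0ℤ ] + + 2 * r                             ≡⟨ cong (_+ + 2 * r) z-0 ⟩
        + (+ s %ℕ 2) + u zero * + 2 + + 2 * r          ≡⟨ eq (+ (+ s %ℕ 2)) (u zero) r ⟩
        + (+ s %ℕ 2) + ∑ u * + 2                       ≡⟨ cong (λ x → + (+ s %ℕ 2) + x * + 2) (trans sum-u (sym (⌊/2⌋≡/ℕ2 s))) ⟩
        + (+ s %ℕ 2) + (+ s /ℕ 2) * + 2                ≡⟨ sym (a≡a%ℕn+[a/ℕn]*n (+ s) 2) ⟩
        + s                                            ∎
        where
        open ≡-Reasoning
        r = ∑ (u ∘ suc)
        eq : ∀ b u r → b + u * + 2 + + 2 * r ≡ b + (u + r) * + 2
        eq = solve-∀

      z-weighted : WeightedSum t z
      -- Pairing leaves t(∑ z - z_0)/2, where ∑ z - z_0 is twice the sum of the u_i with i ≥ 1; that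
      -- sum is the quotient.
      z-weighted = divides (∑ (u ∘ suc)) (trans (ℤ.+-identityʳ _) (2*-cancel (begin
        + 2 * ∑ (λ i → + toℕ i * z i)    ≡⟨ symmetric⇒2*weighted t z z-symmetric ⟩
        + t * (∑ z - z [ 0ℤ ])           ≡⟨ cong (λ x → + t * (x - z [ 0ℤ ])) z-sum ⟩
        + t * (z [ 0ℤ ] + + 2 * r - z [ 0ℤ ]) ≡⟨ eq (+ t) (z [ 0ℤ ]) r ⟩
        + 2 * (r * + t)                  ∎)))
        where
        open ≡-Reasoning
        r = ∑ (u ∘ suc)
        eq : ∀ t z r → t * (z + + 2 * r - z) ≡ + 2 * (r * t)
        eq = solve-∀

      z∈ : UAll t s z
      z∈ = z-sumsTo , z-weighted , z-symmetric

-- Bijections between the parameterizing sets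

module _ {X Y : Setoid 0ℓ 0ℓ} where

  private
    module X = Setoid X
    module Y = Setoid Y

  bijects : ∀ {f P Q} → (∀ {x y} → x X.≈ y → f x Y.≈ f y) → (∀ {x} → P x → Q (f x)) →
    (∀ {x y} → P x → P y → f x Y.≈ f y → x X.≈ y) →
    (∀ {y} → Q y → ∃ λ x → P x × f x Y.≈ y) → Bijects X Y f P Q
  bijects cong maps injective surjective = record
    { maps        = maps
    ; isBijection = record
      { isInjection = record
        { isCongruent = record
          { cong           = cong
          ; isEquivalence₁ = On.isEquivalence proj₁ X.isEquivalence
          ; isEquivalence₂ = On.isEquivalence proj₁ Y.isEquivalence
          }
        ; injective = λ {x} {y} → injective (proj₂ x) (proj₂ y)
        }
      ; surjective = λ (y , qy) → let x , px , fx≈y = surjective qy in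
          (x , px) , λ z≈x → Y.trans (cong z≈x) fx≈y
      }
    }

  -- The preimage supplied by the larger bijection only has to be shown to lie in P′. `reflects`
  -- takes y together with f x ≈ y, because Q′ is known at y and not at f x.
  Bijects-restrict : ∀ {f P Q P′ Q′} → Bijects X Y f P Q →
    (∀ {x} → P′ x → P x) → (∀ {y} → Q′ y → Q y) → (∀ {x} → P′ x → Q′ (f x)) →
    (∀ {x y} → P x → Q′ y → f x Y.≈ y → P′ x) → Bijects X Y f P′ Q′
  Bijects-restrict {f} {P} {Q} {P′} {Q′} bij P′⊆P Q′⊆Q maps reflects = record
    { maps        = maps
    ; isBijection = record
      { isInjection = record
        { isCongruent = record
          { cong           = λ {x} {y} → bij.cong {restrict x} {restrict y}
          ; isEquivalence₁ = On.isEquivalence proj₁ X.isEquivalence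
          ; isEquivalence₂ = On.isEquivalence proj₁ Y.isEquivalence
          }
        ; injective = λ {x} {y} → bij.injective {restrict x} {restrict y}
        }
      ; surjective = λ (y , q′y) → let (x , px) , fx≈y = bij.surjective (y , Q′⊆Q q′y) in
          (x , reflects px q′y (fx≈y {x , px} X.refl)) , λ {z} → fx≈y {restrict z}
      }
    }
    where
    module bij = IsBijection (Bijects.isBijection bij)
    restrict : ∃ P′ → ∃ P
    restrict = Product.map₂ P′⊆P

Bijects-∘ : ∀ {X Y Z : Setoid 0ℓ 0ℓ} {f g P Q R} →
            Bijects X Y f P Q → Bijects Y Z g Q R → Bijects X Z (g ∘ f) P R
Bijects-∘ f-bij g-bij = record
  { maps        = Bijects.maps g-bij ∘ Bijects.maps f-bij
  ; isBijection = isBijection (Bijects.isBijection f-bij) (Bijects.isBijection g-bij)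
  }

aCoords-Bijects : ∀ t .{{_ : NonZero t}} →
  Bijects Partitions (Points t) (aCoords t) (SelfConjugateCore t) (BAll t)
aCoords-Bijects t = bijects
  (λ {l} {m} → aCoords-cong t {l} {m})
  (λ {l} → maps {l})
  (λ {l} {m} (l-core , _) (m-core , _) →
    aCoords-injective t {l} {m} (core⇒closed {l = l} l-core) (core⇒closed {l = m} m-core))
  (λ {a} (_ , residue , symmetric) → let open FromCoords t a residue symmetric in
    partition , (partition-core , partition-selfConjugate) ,
    aCoords-partition t a residue symmetric)
  where
  maps : ∀ {l} → SelfConjugateCore t l → BAll t (aCoords t l)
  maps {l} (core , selfConjugate) = symmetric⇒sumBinomial t symmetric ,
    (λ i → unmod (Tops.residue (aCoords-tops t l) i)) , symmetric
    where
    symmetric : ASymmetric t (aCoords t l)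
    symmetric = selfDual⇒symmetric (aCoords-tops t l) (core⇒closed {l = l} core)
      (selfConjugate⇒selfDual {l} selfConjugate)

aCoords-Bijects-B : ∀ s t .{{_ : NonZero s}} .{{_ : NonZero t}} →
  Bijects Partitions (Points t) (aCoords t)
    (SelfConjugateCore s ∩ SelfConjugateCore t) (B t s)
aCoords-Bijects-B s t = Bijects-restrict (aCoords-Bijects t)
  proj₂
  (λ ((_ , residue , sum) , symmetric) → sum , residue , symmetric)
  (λ {l} ((s-core , _) , t-core) →
    let sum , residue , symmetric = Bijects.maps (aCoords-Bijects t) {l} t-core in
    (closed⇒inequalities (aCoords-tops t l) (core⇒closed {l = l} (proj₁ t-core))
      (core⇒closed {l = l} s-core) , residue , sum) , symmetric)
  (λ {l} {a} t-core ((inequalities , _) , _) a≡ →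
    (closed⇒core {l = l} (inequalities⇒closed (aCoords-tops t l)
      (core⇒closed {l = l} (proj₁ t-core))
      (λ i → subst₂ (λ x y → x - + s ≤ y) (sym (a≡ _)) (sym (a≡ _)) (inequalities i))) ,
    proj₂ t-core) , t-core)

module _ {s t : ℕ} .{{_ : NonZero t}} (coprime : Coprime s t) where

  aToZ-Bijects : Bijects (Points t) (Points t) (aToZ s) (BAll t) (UAll t s)
  aToZ-Bijects = bijects
    (λ {a} {b} → aToZ-cong s t {a} {b})
    (λ {a} → aToZ-maps s t coprime {a})
    (λ {a} {b} → aToZ-injective s t coprime {a} {b})
    (λ {z} z∈ → let open FromZ s t coprime z z∈ in a , a∈ , aToZ-a)

  aToZ-Bijects-U : Bijects (Points t) (Points t) (aToZ s) (B t s) (U t s)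
  aToZ-Bijects-U = Bijects-restrict aToZ-Bijects B⊆BAll
    (λ ((_ , sum , weighted) , symmetric) → sum , weighted , symmetric)
    (λ {a} a∈ → let sum , weighted , symmetric = aToZ-maps s t coprime {a} (B⊆BAll a∈) in
      (inequalities⇒nonNegative s t coprime {a} (proj₁ (proj₂ (proj₁ a∈)))
        (proj₁ (proj₁ a∈)) , sum , weighted) , symmetric)
    (λ {a} (sum , residue , symmetric) ((z≥0 , _) , _) z≡ →
      (nonNegative⇒inequalities s t coprime {a} residue
        (λ i → subst (0ℤ ≤_) (sym (z≡ i)) (z≥0 i)) , residue , sum) , symmetric)
    where
    B⊆BAll : ∀ {a} → B t s a → BAll t a
    B⊆BAll ((_ , residue , sum) , symmetric) = sum , residue , symmetric

module _ (s t : ℕ) .{{_ : NonZero t}} where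

  zToU-Bijects : Bijects (Points t) (Points (suc ⌊ t /2⌋)) zToU (UAll t s) (VAll t s)
  zToU-Bijects = bijects
    (λ {z} {w} → zToU-cong t s {z} {w})
    (λ {z} → zToU-maps t s {z})
    (λ {z} {w} → zToU-injective t s {z} {w})
    (λ {u} sum-u → let open FromU t s u sum-u in z , z∈ , zToU-z)

  zToU-Bijects-V : Bijects (Points t) (Points (suc ⌊ t /2⌋)) zToU (U t s) (V t s)
  zToU-Bijects-V = Bijects-restrict zToU-Bijects U⊆UAll proj₂
    (λ {z} z∈ → nonNegative⇒zToU t s {z} (proj₁ (proj₁ z∈)) , zToU-maps t s {z} (U⊆UAll z∈))
    (λ {z} z∈@(sum , weighted , symmetric) (u≥0 , _) u≡ →
      (zToU⇒nonNegative t s {z} z∈ (λ i → subst (0ℤ ≤_) (sym (u≡ i)) (u≥0 i)) ,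
        sum , weighted) , symmetric)
    where
    U⊆UAll : ∀ {z} → U t s z → UAll t s z
    U⊆UAll ((_ , sum , weighted) , symmetric) = sum , weighted , symmetric

-- The first group certifies that the divisions defining k, the z_j and the middle u-coordinate are
-- exact on the sets concerned; the remaining one, ⌊z_0/2⌋, genuinely rounds.
proposition6p11 : (s t : ℕ) .{{_ : NonZero s}} .{{_ : NonZero t}} → Coprime s t →
    ( 2 ℕ.∣ suc s ℕ.* (t ℕ.∸ 1)
    × (∀ a → a ∈ BAll t → ∀ j → + t ∣ zNumerator s a j)
    × (∀ z → z ∈ UAll t s → 2 ℕ.∣ t → + 2 ∣ z [ + ⌊ t /2⌋ ]) )
    ×
    ( let D = SelfConjugateCore s ∩ SelfConjugateCore t in
    Bijects Partitions (Points t) (aCoords t) D (B t s)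
    × Bijects Partitions (Points t) (aToZ s ∘ aCoords t) D (U t s)
    × Bijects Partitions (Points (suc ⌊ t /2⌋)) (zToU ∘ aToZ s ∘ aCoords t) D (V t s)
    × Bijects (Points t) (Points t) (aToZ s) (B t s) (U t s)
    × Bijects (Points t) (Points (suc ⌊ t /2⌋)) zToU (U t s) (V t s) )
    ×
    ( let D = SelfConjugateCore t in
    Bijects Partitions (Points t) (aCoords t) D (BAll t)
    × Bijects Partitions (Points t) (aToZ s ∘ aCoords t) D (UAll t s)
    × Bijects Partitions (Points (suc ⌊ t /2⌋)) (zToU ∘ aToZ s ∘ aCoords t) D (VAll t s) )
proposition6p11 s t coprime =
  ( shift-even coprime
  , (λ a (_ , residue , _) → residues⇒exact s t a residue)
  , UAll⇒evenMiddle t s )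
  ,
  ( aB , Bijects-∘ aB zU , Bijects-∘ aB (Bijects-∘ zU uV) , zU , uV )
  ,
  ( a , Bijects-∘ a z , Bijects-∘ a (Bijects-∘ z u) )
  where
  aB = aCoords-Bijects-B s t
  zU = aToZ-Bijects-U coprime
  uV = zToU-Bijects-V s t
  a = aCoords-Bijects t
  z = aToZ-Bijects coprime
  u = zToU-Bijects s t
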